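{- If $\mathcal{P}$ is a tight chiral $4$-polytope, then its facets are chiral or its vertex-figures are chiral (or both). If $\mathcal{P}$ is a tight chiral $5$-polytope, then its facets, its vertex-figures, and its medial sections are all chiral.
   Context: An (abstract) $n$-polytope is a partially ordered set with a unique minimal face $F_{ -1}$ and a unique maximal face $F_n$, all of whose maximal chains (flags) have the same length, graded by a rank function with $\operatorname{rank}F_{ -1}=-1$, $\operatorname{rank}F_n=n$, satisfying the diamond condition (if $F<G$ with rank difference $2$, exactly two faces lie strictly between them) and strong connectivity (if $F<G$ with rank difference at least $3$, any two faces strictly between $F$ and $G$ are joined by a chain $H_0\le H_1\ge H_2\le\cdots$ of faces strictly between $F$ and $G$). Faces of rank $0$ are vertices, of rank $n-1$ facets. For $F\le G$ the section $G/F=\{H:F\le H\le G\}$. Facets are identified with the sections $F/F_{ -1}$, vertex-figures are the sections $F_n/v$ for vertices $v$, and medial sections are the sections $F/v$ for a facet $F$ and vertex $v\le F$. Flags differing in one face are adjacent. A polytope is regular if its automorphism group acts transitively on flags, and chiral if the flags form exactly two orbits with adjacent flags in different orbits. A polytope is equivelar of type $\{p_1,\dots,p_{n-1}\}$ if for each $i$, every section $G/F$ with $F$ an $(i-2)$-face and $G$ an $(i+1)$-face is (the face lattice of) a $p_i$-gon; it is tight if it is equivelar of some type $\{p_1,\dots,p_{n-1}\}$ and has exactly $2p_1\cdots p_{n-1}$ flags. -}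

module Defs where

open import Data.Nat using (ℕ; zero; suc; _+_; _*_; _∸_; _<_) renaming (_≤_ to _≤ℕ_)
open import Data.Fin using (Fin; toℕ)
import Data.Fin as Fin
open import Data.Product using (Σ; ∃; ∃-syntax; _×_; _,_; proj₁)
open import Data.Sum using (_⊎_)
open import Data.Unit using (⊤)
open import Data.Empty using (⊥)
open import Relation.Nullary using (¬_)
open import Relation.Binary.PropositionalEquality using (_≡_; _≢_)
open import Relation.Binary.Construct.Closure.ReflexiveTransitive using (Star)

-- A "graded poset of rank n": faces, an order relation and a rank
-- function.  CONVENTION: ranks are SHIFTED by one, so that
-- rank F_{-1} = 0 and rank F_n = n + 1 (paper's rank = rank - 1).

record GradedPoset (n : ℕ) : Set₁ where
  field
    Face : Set
    _≤_  : Face → Face → Set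
    rank : Face → ℕ

module _ {n : ℕ} (P : GradedPoset n) where
  open GradedPoset P

  _<_ₚ : Face → Face → Set
  x < y ₚ = x ≤ y × x ≢ y

  Between : Face → Face → Face → Set
  Between x y z = (x < z ₚ) × (z < y ₚ)

  CompStep : Face → Face → Face → Face → Set
  CompStep x y a b = Between x y a × Between x y b × (a ≤ b ⊎ b ≤ a)

  record IsPolytope : Set where
    field
      ≤-refl       : ∀ x → x ≤ x
      ≤-antisym    : ∀ {x y} → x ≤ y → y ≤ x → x ≡ y
      ≤-trans      : ∀ {x y z} → x ≤ y → y ≤ z → x ≤ z
      ≤-irrelevant : ∀ {x y} (p q : x ≤ y) → p ≡ q
      bottom       : Face
      bottom-least : ∀ x → bottom ≤ x
      top          : Face
      top-greatest : ∀ x → x ≤ top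
      rank-bottom  : rank bottom ≡ 0
      rank-top     : rank top ≡ suc n
      -- graded: rank strictly monotone, and covering pairs differ by 1
      -- (so all maximal chains have n+2 faces)
      rank-mono    : ∀ {x y} → x < y ₚ → rank x < rank y
      graded       : ∀ {x y} → x < y ₚ → suc (rank x) < rank y →
                     ∃[ z ] Between x y z
      diamond      : ∀ {x y} → x ≤ y → rank y ≡ 2 + rank x →
                     ∃[ z₁ ] ∃[ z₂ ] (z₁ ≢ z₂ × Between x y z₁ × Between x y z₂ ×
                       (∀ z → Between x y z → z ≡ z₁ ⊎ z ≡ z₂))
      strongly-connected : ∀ {x y} → x ≤ y → 3 + rank x ≤ℕ rank y →
                     ∀ a b → Between x y a → Between x y b →
                     Star (CompStep x y) a b

  -- Flags: one face of each (shifted) rank 0 .. n+1, forming a chain.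
  -- In a polytope these are exactly the maximal chains.
  record Flag : Set where
    field
      face    : Fin (2 + n) → Face
      rank-ok : ∀ i → rank (face i) ≡ toℕ i
      chain   : ∀ i j → toℕ i ≤ℕ toℕ j → face i ≤ face j
  open Flag public

  _≈F_ : Flag → Flag → Set
  Φ ≈F Ψ = ∀ i → face Φ i ≡ face Ψ i

  Adjacent : Flag → Flag → Set
  Adjacent Φ Ψ = ∃[ i ] (face Φ i ≢ face Ψ i × (∀ j → j ≢ i → face Φ j ≡ face Ψ j))

  record Automorphism : Set where
    field
      fun      : Face → Face
      inv      : Face → Face
      inv-fun  : ∀ x → inv (fun x) ≡ x
      fun-inv  : ∀ x → fun (inv x) ≡ x
      fun-mono : ∀ {x y} → x ≤ y → fun x ≤ fun y
      fun-refl : ∀ {x y} → fun x ≤ fun y → x ≤ y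

  SameOrbit : Flag → Flag → Set
  SameOrbit Φ Ψ = ∃[ φ ] (∀ i → Automorphism.fun φ (face Φ i) ≡ face Ψ i)

  Regular : Set
  Regular = ∀ Φ Ψ → SameOrbit Φ Ψ

  Chiral : Set
  Chiral = (∃[ Φ₀ ] ∃[ Φ₁ ] (¬ SameOrbit Φ₀ Φ₁ × (∀ Ψ → SameOrbit Φ₀ Ψ ⊎ SameOrbit Φ₁ Ψ)))
           × (∀ Φ Ψ → Adjacent Φ Ψ → ¬ SameOrbit Φ Ψ)

  HasFlagCount : ℕ → Set
  HasFlagCount N = Σ (Fin N → Flag) λ e →
    (∀ a b → e a ≈F e b → a ≡ b) × (∀ Φ → ∃[ a ] (e a ≈F Φ))

Section : ∀ {n} (P : GradedPoset n) → GradedPoset.Face P → GradedPoset.Face P →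
          (k : ℕ) → GradedPoset k
Section P F G k = record
  { Face = Σ (GradedPoset.Face P) (λ H → GradedPoset._≤_ P F H × GradedPoset._≤_ P H G)
  ; _≤_  = λ a b → GradedPoset._≤_ P (proj₁ a) (proj₁ b)
  ; rank = λ a → GradedPoset.rank P (proj₁ a) ∸ GradedPoset.rank P F
  }

-- The face lattice of the standard p-gon: vertices 0..p-1, edges
-- 0..p-1, edge e has vertices e and e+1 (mod p).

data PGonFace (p : ℕ) : Set where
  pbot : PGonFace p
  vert : Fin p → PGonFace p
  edge : Fin p → PGonFace p
  ptop : PGonFace p

Incident : ∀ {p} → Fin p → Fin p → Set
Incident {p} j e = toℕ j ≡ toℕ e ⊎ toℕ j ≡ suc (toℕ e) ⊎ (toℕ j ≡ 0 × suc (toℕ e) ≡ p)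

_≤PG_ : ∀ {p} → PGonFace p → PGonFace p → Set
pbot   ≤PG _      = ⊤
vert j ≤PG vert k = j ≡ k
vert j ≤PG edge e = Incident j e
vert j ≤PG ptop   = ⊤
edge e ≤PG edge f = e ≡ f
edge e ≤PG ptop   = ⊤
ptop   ≤PG ptop   = ⊤
_      ≤PG _      = ⊥

IsPGon : ∀ {k} → GradedPoset k → ℕ → Set
IsPGon Q p = Σ (GradedPoset.Face Q → PGonFace p) λ to →
             Σ (PGonFace p → GradedPoset.Face Q) λ from →
             (∀ x → from (to x) ≡ x) × (∀ y → to (from y) ≡ y) ×
             (∀ x y → GradedPoset._≤_ Q x y → to x ≤PG to y) ×
             (∀ x y → to x ≤PG to y → GradedPoset._≤_ Q x y)

prodFin : ∀ m → (Fin m → ℕ) → ℕ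
prodFin zero    f = 1
prodFin (suc m) f = f Fin.zero * prodFin m (λ i → f (Fin.suc i))

-- Equivelar of type {p_1,...,p_{n-1}}, where p_{j+1} = p j.
-- Section G/F with paper-rank F = j-1 and G = j+2 (shifted: j and j+3).
Equivelar : ∀ {n} → GradedPoset n → (Fin (n ∸ 1) → ℕ) → Set
Equivelar P p = ∀ j F G → GradedPoset.rank P F ≡ toℕ j → GradedPoset.rank P G ≡ 3 + toℕ j →
                GradedPoset._≤_ P F G → IsPGon (Section P F G 2) (p j)

Tight : ∀ {n} → GradedPoset n → Set
Tight {n} P = Σ (Fin (n ∸ 1) → ℕ) λ p → Equivelar P p × HasFlagCount P (2 * prodFin (n ∸ 1) p)

FacetsChiral : ∀ {n} → GradedPoset n → Set
FacetsChiral {n} P = ∀ B F → GradedPoset.rank P B ≡ 0 → GradedPoset.rank P F ≡ n →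
                     GradedPoset._≤_ P B F → Chiral (Section P B F (n ∸ 1))

VertexFiguresChiral : ∀ {n} → GradedPoset n → Set
VertexFiguresChiral {n} P = ∀ v T → GradedPoset.rank P v ≡ 1 → GradedPoset.rank P T ≡ suc n →
                     GradedPoset._≤_ P v T → Chiral (Section P v T (n ∸ 1))

MedialSectionsChiral : ∀ {n} → GradedPoset n → Set
MedialSectionsChiral {n} P = ∀ v F → GradedPoset.rank P v ≡ 1 → GradedPoset.rank P F ≡ n →
                     GradedPoset._≤_ P v F → Chiral (Section P v F (n ∸ 2))

{-# OPTIONS --safe #-}
module Submission where

-- Let rₜ be the involution of the flags changing the face of rank t.  A chiral polytope has two
-- orbits of flags, so it (or a section of it) fails to be chiral exactly when every relation,
-- i.e. every word in its rₜ that fixes some flag, fixes all flags.  In a tight polytope the count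
-- of flags forces every flag of a rank-three section to be obtained from a given one by a word in
-- the first two generators followed by a power of the rotation on the last two.  Rewriting words
-- with these relations, if they hold at all flags, pushes the top generator to the right, so all
-- relations follow from those of the rank-three sections at the top and of the facets.  In rank 4,
-- facets and vertex-figures therefore cannot both be regular.  In rank 5, the relations of the
-- 3-faces hold at all flags because those words commute with r₅, and dually, so a regular medial
-- section would make first the facets and then the whole polytope regular.

open import Defs
open import Data.Nat hiding (_/_)
open import Data.Nat.Properties
open import Data.Nat.Solver using (module +-*-Solver)
open import Data.Nat.DivMod using (_%_; m%n<n; n%n≡0; m%n%n≡m%n; m<n⇒m%n≡m; [m+n]%n≡m%n; %-distribˡ-+)
open import Data.Fin using (Fin; toℕ; fromℕ<; remQuot; combine; punchOut)
open import Data.Fin.Properties using (toℕ<n; toℕ-fromℕ<; toℕ-injective; any?; all?; combine-remQuot; injective⇒≤; punchOut-injective)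
open import Data.Fin.Patterns using (0F; 1F; 2F; 3F)
import Data.Fin as Fin
import Data.Fin.Properties as Finₚ
open import Data.List using (List; []; _∷_; _++_; reverse; [_])
open import Data.List.Properties using (unfold-reverse; ++-assoc)
open import Data.List.Relation.Unary.All as All using (All; []; _∷_)
open import Data.List.Relation.Unary.All.Properties using (++⁺)
import Data.Vec as Vec
open import Data.Vec using (Vec; lookup; tabulate)
open import Data.Vec.Properties using (lookup∘tabulate)
open import Data.Product
open import Data.Sum using (_⊎_; inj₁; inj₂; [_,_]′)
open import Data.Empty using (⊥-elim)
open import Function using (_∘_; const; id)
open import Relation.Nullary
open import Relation.Nullary.Decidable using (_×-dec_; _→-dec_; ¬¬-excluded-middle)
open import Relation.Binary.PropositionalEquality hiding ([_])
open import Relation.Binary.Construct.Closure.ReflexiveTransitive using (Star; ε; _◅_)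
open import Relation.Binary.Definitions using (tri<; tri≈; tri>)

-- Chirality of a section concerns the automorphisms of that section, whereas the hypotheses supply
-- automorphisms of `P`. The bridge is a flag a together with `r t a` for some t inside the section:
-- the two represent both orbits of `P`, so a word fixing both fixes every flag. An automorphism of
-- the section taking one to the other makes the words that fix them coincide, and so yields `Reg`.
-- If `Reg` fails, no such automorphism exists, while restricting automorphisms of `P` still leaves
-- at most two orbits on the section. Hence refuting `Reg` is all that chirality of a section
-- requires. In rank 5 all conclusions follow from such refutations. In rank 4 the conclusion is a
-- disjunction, and refuting two `Reg` statements jointly does not tell which one fails; so `Reg`
-- has to be decided there, by a search among self-maps of the finite set of flags.

module _ {A : Set} where

  cat : ℕ → (ℕ → A) → (ℕ → A) → ℕ → A
  cat s f g i with i <? s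
  ... | yes _ = f i
  ... | no  _ = g i

  cat-< : ∀ {s f g i} → i < s → cat s f g i ≡ f i
  cat-< {s} {i = i} p with i <? s
  ... | yes _ = refl
  ... | no ¬p = contradiction p ¬p

  cat-≥ : ∀ {s f g i} → s ≤ i → cat s f g i ≡ g i
  cat-≥ {s} {i = i} p with i <? s
  ... | yes q = contradiction p (<⇒≱ q)
  ... | no  _ = refl

Outside : ℕ → ℕ → ℕ → Set
Outside lo hi i = i ≤ lo ⊎ hi ≤ i

Inside : ℕ → ℕ → ℕ → Set
Inside lo hi t = lo < t × t < hi

out≢in : ∀ {lo hi i t} → Outside lo hi i → Inside lo hi t → i ≢ t
out≢in (inj₁ i≤lo) (lo<t , _) refl = <⇒≱ lo<t i≤lo
out≢in (inj₂ hi≤i) (_ , t<hi) refl = <⇒≱ t<hi hi≤i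

-- Flags as chains indexed by rank.

module Flags {n : ℕ} (P : GradedPoset n) (isP : IsPolytope P) {N : ℕ} (count : HasFlagCount P N) where

  open GradedPoset P using (Face; rank) renaming (_≤_ to _⊑_) public
  open IsPolytope isP renaming (≤-refl to ⊑-refl; ≤-antisym to ⊑-antisym; ≤-trans to ⊑-trans; ≤-irrelevant to ⊑-irrelevant) public

  X : Set
  X = Fin N

  flag : X → Flag P
  flag = proj₁ count

  opaque
    rank-≤ : ∀ {x y} → x ⊑ y → rank x ≤ rank y
    rank-≤ {x} {y} p with rank x ≤? rank y
    ... | yes q = q
    ... | no ¬q = contradiction (rank-mono (p , λ { refl → ¬q ≤-refl })) (<⇒≯ (≰⇒> ¬q))

  rank-≤top : ∀ x → rank x < 2 + n
  rank-≤top x = s≤s (subst (rank x ≤_) rank-top (rank-≤ (top-greatest x)))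

  rank≢ : ∀ {x y} → rank x < rank y → x ≢ y
  rank≢ p refl = <-irrefl refl p

  -- The range of ranks is half-open and values of `f` outside it are arbitrary; hence pieces can be
  -- glued with `cat` once a single comparison at the seam is known.
  record Seq (lo hi : ℕ) (f : ℕ → Face) : Set where
    constructor seq
    field
      rk : ∀ i → lo ≤ i → i < hi → rank (f i) ≡ i
      st : ∀ i → lo ≤ i → suc i < hi → f i ⊑ f (suc i)

  open Seq

  seq-mono : ∀ {lo hi f} → Seq lo hi f → ∀ i j → lo ≤ i → i ≤ j → j < hi → f i ⊑ f j
  seq-mono {f = f} s i zero l z≤n h = ⊑-refl (f 0)
  seq-mono s i (suc j) l i≤j h with m≤n⇒m<n∨m≡n i≤j
  ... | inj₂ refl = ⊑-refl _
  ... | inj₁ (s≤s i≤j′) =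
    ⊑-trans (seq-mono s i j l i≤j′ (<-trans (n<1+n j) h)) (st s j (≤-trans l i≤j′) h)

  seq-weaken : ∀ {lo lo′ hi hi′ f} → lo ≤ lo′ → hi′ ≤ hi → Seq lo hi f → Seq lo′ hi′ f
  seq-weaken l h (seq r s) =
    seq (λ i p q → r i (≤-trans l p) (<-≤-trans q h)) (λ i p q → s i (≤-trans l p) (<-≤-trans q h))

  seq-const : ∀ x {i} → rank x ≡ i → Seq i (suc i) (const x)
  seq-const x refl = seq (λ i p q → ≤-antisym p (≤-pred q)) (λ _ _ _ → ⊑-refl x)

  cat-seq : ∀ {lo s hi f g} → Seq lo s f → Seq s hi g →
            (∀ i → suc i ≡ s → lo ≤ i → s < hi → f i ⊑ g s) → Seq lo hi (cat s f g)
  cat-seq {lo} {s} {hi} {f} {g} F G J = seq r t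
    where
    r : ∀ i → lo ≤ i → i < hi → rank (cat s f g i) ≡ i
    r i p q with i <? s
    ... | yes i<s = rk F i p i<s
    ... | no i≮s = rk G i (≮⇒≥ i≮s) q
    t : ∀ i → lo ≤ i → suc i < hi → cat s f g i ⊑ cat s f g (suc i)
    t i p q with <-cmp (suc i) s
    ... | tri< a _ _ = subst₂ _⊑_ (sym (cat-< (<-trans (n<1+n i) a))) (sym (cat-< a)) (st F i p a)
    ... | tri≈ _ refl _ = subst₂ _⊑_ (sym (cat-< (n<1+n i))) (sym (cat-≥ {s = suc i} ≤-refl)) (J i refl p q)
    ... | tri> _ _ (s≤s c) = subst₂ _⊑_ (sym (cat-≥ c)) (sym (cat-≥ (m≤n⇒m≤1+n c))) (st G i c q)

  -- Gradedness inserts a face as long as the ranks differ by at least two, and both halves are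
  -- filled recursively; `d` bounds the rank difference and serves as fuel.
  saturate : ∀ d x y → x ⊑ y → rank x < rank y → rank y ≤ d + rank x →
             ∃[ f ] (Seq (rank x) (suc (rank y)) f × f (rank x) ≡ x × f (rank y) ≡ y)
  saturate zero x y x⊑y x<y y≤x = contradiction y≤x (<⇒≱ x<y)
  saturate (suc d) x y x⊑y x<y y≤d with m≤n⇒m<n∨m≡n x<y
  ... | inj₂ eq = cat (rank y) (const x) (const y) ,
      cat-seq (subst (λ h → Seq (rank x) h (const x)) eq (seq-const x refl)) (seq-const y refl) (λ _ _ _ _ → x⊑y) ,
      cat-< x<y , cat-≥ {s = rank y} ≤-refl
  ... | inj₁ gap with graded (x⊑y , rank≢ x<y) gap
  ...   | z , (x⊏z , z⊏y)
        with saturate d x z (proj₁ x⊏z) (rank-mono x⊏z) (≤-pred (≤-trans (rank-mono z⊏y) y≤d))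
           | saturate d z y (proj₁ z⊏y) (rank-mono z⊏y)
               (≤-trans y≤d (subst (_≤ d + rank z) (+-suc d (rank x)) (+-monoʳ-≤ d (rank-mono x⊏z))))
  ...     | f , F , fx , fz | g , G , gz , gy =
      cat (rank z) f g ,
      cat-seq (seq-weaken ≤-refl (n≤1+n _) F) G
        (λ i eq l _ → subst (f i ⊑_) (trans (cong f eq) (trans fz (sym gz))) (st F i l (subst (_< suc (rank z)) (sym eq) ≤-refl))) ,
      trans (cat-< (rank-mono x⊏z)) fx , trans (cat-≥ (<⇒≤ (rank-mono z⊏y))) gy

  lower : ∀ x → ∃[ f ] (Seq 0 (suc (rank x)) f × f (rank x) ≡ x)
  lower x with 0 <? rank x
  ... | no p = const x , subst (λ l → Seq l (suc (rank x)) (const x)) (n<1⇒n≡0 (≰⇒> p)) (seq-const x refl) , refl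
  ... | yes p with saturate (rank x) bottom x (bottom-least x) (subst (_< rank x) (sym rank-bottom) p) (m≤m+n _ _)
  ...   | f , F , _ , e = f , subst (λ l → Seq l (suc (rank x)) f) rank-bottom F , e

  upper : ∀ x → ∃[ f ] (Seq (rank x) (2 + n) f × f (rank x) ≡ x)
  upper x with rank x <? suc n
  ... | no p = const x , subst (λ h → Seq (rank x) h (const x)) (cong suc (≤-antisym (≤-pred (rank-≤top x)) (≮⇒≥ p))) (seq-const x refl) , refl
  ... | yes p with saturate (suc n) x top (top-greatest x) (subst (rank x <_) (sym rank-top) p) (subst (_≤ suc n + rank x) (sym rank-top) (m≤m+n _ _))
  ...   | f , F , e , _ = f , subst (λ h → Seq (rank x) h f) (cong suc rank-top) F , e

  -- Faces are indexed by ℕ; beyond the last rank n + 1 the index is cut off.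
  clamp : ℕ → Fin (2 + n)
  clamp i = fromℕ< (s≤s (m⊓n≤n i (suc n)))

  toℕ-clamp : ∀ {i} → i < 2 + n → toℕ (clamp i) ≡ i
  toℕ-clamp {i} p = trans (toℕ-fromℕ< _) (m≤n⇒m⊓n≡m (≤-pred p))

  clamp-toℕ : ∀ i → clamp (toℕ i) ≡ i
  clamp-toℕ i = toℕ-injective (toℕ-clamp (toℕ<n i))

  opaque
    fc : X → ℕ → Face
    fc a i = face (flag a) (clamp i)

    fc-flag : ∀ a i → face (flag a) i ≡ fc a (toℕ i)
    fc-flag a i = cong (face (flag a)) (sym (clamp-toℕ i))

    fc-rank : ∀ a {i} → i < 2 + n → rank (fc a i) ≡ i
    fc-rank a p = trans (rank-ok (flag a) _) (toℕ-clamp p)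

    fc-mono : ∀ a {i j} → i ≤ j → fc a i ⊑ fc a j
    fc-mono a {i} {j} p = chain (flag a) _ _
      (subst₂ _≤_ (sym (toℕ-fromℕ< _)) (sym (toℕ-fromℕ< _)) (⊓-monoˡ-≤ (suc n) p))

    fc-over : ∀ a {i} → 2 + n ≤ i → fc a i ≡ fc a (suc n)
    fc-over a {i} p = cong (face (flag a)) (toℕ-injective
      (trans (toℕ-fromℕ< _) (trans (m≥n⇒m⊓n≡n (<⇒≤ p)) (sym (toℕ-clamp (n<1+n (suc n)))))))

  fc-ext : ∀ {a b} → (∀ i → i < 2 + n → fc a i ≡ fc b i) → a ≡ b
  fc-ext {a} {b} h = proj₁ (proj₂ count) a b
    (λ i → trans (fc-flag a i) (trans (h (toℕ i) (toℕ<n i)) (sym (fc-flag b i))))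

  fc-seq : ∀ a → Seq 0 (2 + n) (fc a)
  fc-seq a = seq (λ i _ p → fc-rank a p) (λ i _ _ → fc-mono a (n≤1+n i))

  mkFlag : ∀ {f} → Seq 0 (2 + n) f → Flag P
  mkFlag {f} s = record
    { face = f ∘ toℕ
    ; rank-ok = λ i → rk s (toℕ i) z≤n (toℕ<n i)
    ; chain = λ i j p → seq-mono s (toℕ i) (toℕ j) z≤n p (toℕ<n j) }

  index : Flag P → X
  index Φ = proj₁ (proj₂ (proj₂ count) Φ)

  fc-index : ∀ Φ i → fc (index Φ) (toℕ i) ≡ face Φ i
  fc-index Φ i = trans (sym (fc-flag (index Φ) i)) (proj₂ (proj₂ (proj₂ count) Φ) i)

  mk : ∀ {f} → Seq 0 (2 + n) f → X
  mk s = index (mkFlag s)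

  fc-mk : ∀ {f} (s : Seq 0 (2 + n) f) {i} → i < 2 + n → fc (mk s) i ≡ f i
  fc-mk {f} s {i} p = subst (λ k → fc (mk s) k ≡ f k) (toℕ-clamp p) (fc-index (mkFlag s) (clamp i))

  -- Equality of faces is not assumed decidable, but equality of flags is: compare
  -- the two flags obtained by completing x and y with the same other faces.
  ⊑-rank-≡ : ∀ {x y} → x ⊑ y → rank x ≡ rank y → x ≡ y
  ⊑-rank-≡ {x} {y} x⊑y eq with lower x | upper y
  ... | f , F , fx | g , G , gy = result
    where
    s = rank x
    G′ : Seq s (2 + n) g
    G′ = subst (λ l → Seq l (2 + n) g) (sym eq) G
    gs : g s ≡ y
    gs = trans (cong g eq) gy
    below : ∀ i → suc i ≡ s → f i ⊑ g s
    below i q = subst (f i ⊑_) (sym gs) (⊑-trans (subst (f i ⊑_) (trans (cong f q) fx)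
      (st F i z≤n (s≤s (≤-reflexive q)))) x⊑y)
    B : Seq 0 (2 + n) (cat s f g)
    B = cat-seq (seq-weaken z≤n (n≤1+n s) F) G′ (λ i q _ _ → below i q)
    A : Seq 0 (2 + n) (cat (suc s) f g)
    A = cat-seq F (seq-weaken (n≤1+n s) ≤-refl G′) λ { i refl _ q →
      subst (_⊑ g (suc s)) (sym fx) (⊑-trans x⊑y (subst (_⊑ g (suc s)) gs (st G′ s ≤-refl q))) }
    s<2+n = rank-≤top x
    same : x ≡ y → mk A ≡ mk B
    same x≡y = fc-ext λ i p → trans (fc-mk A p) (trans (pointwise i) (sym (fc-mk B p)))
      where
      pointwise : ∀ i → cat (suc s) f g i ≡ cat s f g i
      pointwise i with <-cmp i s
      ... | tri< l _ _ = trans (cat-< (m≤n⇒m≤1+n l)) (sym (cat-< l))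
      ... | tri≈ _ refl _ = trans (cat-< {s = suc s} ≤-refl) (trans fx (trans x≡y (trans (sym gs) (sym (cat-≥ {s = s} ≤-refl)))))
      ... | tri> _ _ l = trans (cat-≥ l) (sym (cat-≥ (<⇒≤ l)))
    result : x ≡ y
    result with mk A Fin.≟ mk B
    ... | yes p = trans (sym fx) (trans (sym (cat-< {s = suc s} ≤-refl)) (trans (sym (fc-mk A s<2+n))
            (trans (cong (λ a → fc a s) p) (trans (fc-mk B s<2+n) (trans (cat-≥ {s = s} ≤-refl) gs)))))
    -- Different flags exclude `x ≡ y`, so x lies strictly below y, against the equality of ranks.
    ... | no ¬p = contradiction (rank-mono (x⊑y , λ q → ¬p (same q))) (<-irrefl eq)

  -- Splicing flags.

  Valid : ℕ → Set
  Valid = Inside 0 (suc n)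

  opaque
    join : ∀ s a b → s ≤ suc n → fc a s ≡ fc b s →
           ∃[ c ] ((∀ i → i ≤ s → fc c i ≡ fc a i) × (∀ i → s ≤ i → fc c i ≡ fc b i))
    join s a b s≤ eq = c , low , high
      where
      S : Seq 0 (2 + n) (cat s (fc a) (fc b))
      S = cat-seq (seq-weaken z≤n (m≤n⇒m≤1+n s≤) (fc-seq a)) (seq-weaken z≤n ≤-refl (fc-seq b))
            (λ i q _ _ → subst (fc a i ⊑_) eq (fc-mono a (<⇒≤ (≤-reflexive q))))
      c : X
      c = mk S
      high′ : ∀ i → i < 2 + n → s ≤ i → fc c i ≡ fc b i
      high′ i p q = trans (fc-mk S p) (cat-≥ q)
      low : ∀ i → i ≤ s → fc c i ≡ fc a i
      low i q with m≤n⇒m<n∨m≡n q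
      ... | inj₁ q′ = trans (fc-mk S (≤-trans (s≤s q) (s≤s s≤))) (cat-< q′)
      ... | inj₂ refl = trans (high′ s (s≤s s≤) ≤-refl) (sym eq)
      high : ∀ i → s ≤ i → fc c i ≡ fc b i
      high i q with i <? 2 + n
      ... | yes p = high′ i p q
      ... | no ¬p = trans (fc-over c (≮⇒≥ ¬p)) (trans (high′ (suc n) ≤-refl s≤) (sym (fc-over b (≮⇒≥ ¬p))))

  saturate′ : ∀ {x y i j} → x ⊑ y → rank x ≡ i → rank y ≡ j → i < j →
              ∃[ f ] (Seq i (suc j) f × f i ≡ x × f j ≡ y)
  saturate′ {x} {y} p refl refl q = saturate (rank y) x y p q (m≤m+n _ _)

  opaque
    -- The chains from rank `lo` to `H` and from `H` to rank `hi` are newly chosen, so between these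
    -- ranks only `H` itself is controlled.
    insert : ∀ a {lo s hi H} → lo < s → s < hi → hi ≤ suc n → rank H ≡ s → fc a lo ⊑ H → H ⊑ fc a hi →
             ∃[ c ] (fc c s ≡ H × (∀ i → Outside lo hi i → fc c i ≡ fc a i))
    insert a {lo} {s} {hi} {H} lo<s s<hi hi≤ rH p q
      with saturate′ p (fc-rank a (<-trans lo<s (<-trans s<hi (s≤s hi≤)))) rH lo<s
         | saturate′ q rH (fc-rank a (s≤s hi≤)) s<hi
    ... | f , F , flo , fs | g , G , gs , ghi = c , at , out
      where
      lo<hi : lo < hi
      lo<hi = <-trans lo<s s<hi
      S₂ : Seq s (2 + n) (cat hi g (fc a))
      S₂ = cat-seq (seq-weaken ≤-refl (n≤1+n hi) G) (seq-weaken z≤n ≤-refl (fc-seq a))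
             λ i e l _ → subst (g i ⊑_) (trans (cong g e) ghi) (st G i l (s≤s (≤-reflexive e)))
      g≡H : cat hi g (fc a) s ≡ H
      g≡H = trans (cat-< s<hi) gs
      S₁ : Seq lo (2 + n) (cat s f (cat hi g (fc a)))
      S₁ = cat-seq (seq-weaken ≤-refl (n≤1+n s) F) S₂
             λ i e l _ → subst (f i ⊑_) (trans (cong f e) (trans fs (sym g≡H))) (st F i l (s≤s (≤-reflexive e)))
      f≡lo : cat s f (cat hi g (fc a)) lo ≡ fc a lo
      f≡lo = trans (cat-< lo<s) flo
      S₀ : Seq 0 (2 + n) (cat lo (fc a) (cat s f (cat hi g (fc a))))
      S₀ = cat-seq (seq-weaken z≤n (<⇒≤ (<-trans lo<hi (s≤s hi≤))) (fc-seq a)) S₁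
             λ i e _ _ → subst (fc a i ⊑_) (sym f≡lo) (fc-mono a (<⇒≤ (≤-reflexive e)))
      c : X
      c = mk S₀
      at : fc c s ≡ H
      at = trans (fc-mk S₀ (<-trans s<hi (s≤s hi≤))) (trans (cat-≥ (<⇒≤ lo<s)) (trans (cat-≥ {s = s} ≤-refl) g≡H))
      upper′ : ∀ i → i < 2 + n → hi ≤ i → fc c i ≡ fc a i
      upper′ i p h = trans (fc-mk S₀ p) (trans (cat-≥ (≤-trans (<⇒≤ lo<hi) h)) (trans (cat-≥ (≤-trans (<⇒≤ s<hi) h)) (cat-≥ h)))
      out : ∀ i → Outside lo hi i → fc c i ≡ fc a i
      out i (inj₂ h) with i <? 2 + n
      ... | yes p = upper′ i p h
      ... | no ¬p = trans (fc-over c (≮⇒≥ ¬p)) (trans (upper′ (suc n) ≤-refl hi≤) (sym (fc-over a (≮⇒≥ ¬p))))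
      out i (inj₁ h) with m≤n⇒m<n∨m≡n h
      ... | inj₁ l = trans (fc-mk S₀ (<-trans l (<-trans lo<hi (s≤s hi≤)))) (cat-< l)
      ... | inj₂ refl = trans (fc-mk S₀ (<-trans lo<hi (s≤s hi≤))) (trans (cat-≥ {s = lo} ≤-refl) f≡lo)

    replace : ∀ a {t z} → Valid t → rank z ≡ t → fc a (pred t) ⊑ z → z ⊑ fc a (suc t) →
              ∃[ c ] (fc c t ≡ z × (∀ i → i ≢ t → fc c i ≡ fc a i))
    replace a {suc s} (_ , s<n) rz p q with insert a (n<1+n s) (n<1+n (suc s)) s<n rz p q
    ... | c , at , out = c , at , λ i i≢ → out i (outside i i≢)
      where
      outside : ∀ i → i ≢ suc s → Outside s (2 + s) i
      outside i i≢ with <-cmp i (suc s)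
      ... | tri< l _ _ = inj₁ (≤-pred l)
      ... | tri≈ _ e _ = contradiction e i≢
      ... | tri> _ _ l = inj₂ l

  -- The flag involutions.

  fc-< : ∀ a {i j} → i < j → j < 2 + n → _<_ₚ P (fc a i) (fc a j)
  fc-< a {i} {j} p q = fc-mono a (<⇒≤ p) ,
    rank≢ (subst₂ _<_ (sym (fc-rank a (<-trans p q))) (sym (fc-rank a q)) p)

  fc-between : ∀ a {lo i hi} → lo < i → i < hi → hi < 2 + n → Between P (fc a lo) (fc a hi) (fc a i)
  fc-between a p q h = fc-< a p (<-trans q h) , fc-< a q h

  opaque
    between-rank : ∀ a {lo hi z} → lo < hi → hi < 2 + n → Between P (fc a lo) (fc a hi) z → Inside lo hi (rank z)
    between-rank a p q (u , v) =
      subst (_< _) (fc-rank a (<-trans p q)) (rank-mono u) , subst (_ <_) (fc-rank a q) (rank-mono v)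

  -- The diamond condition itself tells which of its two faces the flag contains, in place of a
  -- decision of equality of faces; the neighbour takes the other one. The last clause is what later
  -- identifies a flag as this neighbour.
  flip : ∀ t → Valid t → ∀ a → ∃[ b ] ((∀ i → i ≢ t → fc b i ≡ fc a i) × fc b t ≢ fc a t ×
           (∀ c → (∀ i → i ≢ t → fc c i ≡ fc a i) → c ≡ a ⊎ c ≡ b))
  flip (suc s) v@(_ , s<n) a with diamond {fc a s} {fc a (2 + s)} (fc-mono a (≤-trans (n≤1+n s) (n≤1+n (suc s))))
       (trans (fc-rank a (s≤s s<n)) (cong (2 +_) (sym (fc-rank a (<-trans (n<1+n s) (<-trans s<n (n<1+n _)))))))
  ... | z₁ , z₂ , z₁≢z₂ , B₁ , B₂ , only = result (only (fc a t) (mid a))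
    where
    t = suc s
    mid : ∀ c → Between P (fc c s) (fc c (suc t)) (fc c t)
    mid c = fc-between c (n<1+n s) (n<1+n t) (s≤s s<n)
    rk-mid : ∀ {z} → Between P (fc a s) (fc a (suc t)) z → rank z ≡ t
    rk-mid B with between-rank a (<-trans (n<1+n s) (n<1+n t)) (s≤s s<n) B
    ... | p , q = ≤-antisym (≤-pred q) p
    s≢t : s ≢ t
    s≢t = <⇒≢ (n<1+n s)
    st≢t : suc t ≢ t
    st≢t = ≢-sym (<⇒≢ (n<1+n t))
    other : ∀ z z′ → fc a t ≡ z → z ≢ z′ → Between P (fc a s) (fc a (suc t)) z′ →
            (∀ w → Between P (fc a s) (fc a (suc t)) w → w ≡ z ⊎ w ≡ z′) →
            ∃[ b ] ((∀ i → i ≢ t → fc b i ≡ fc a i) × fc b t ≢ fc a t ×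
              (∀ c → (∀ i → i ≢ t → fc c i ≡ fc a i) → c ≡ a ⊎ c ≡ b))
    other z z′ e z≢z′ B only′ with replace a v (rk-mid B) (proj₁ (proj₁ B)) (proj₁ (proj₂ B))
    ... | b , at , out = b , out , (λ eq → z≢z′ (trans (sym e) (trans (sym eq) at))) , uniq
      where
      uniq : ∀ c → (∀ i → i ≢ t → fc c i ≡ fc a i) → c ≡ a ⊎ c ≡ b
      uniq c h with only′ (fc c t) (subst₂ (λ x y → Between P x y (fc c t)) (h s s≢t) (h (suc t) st≢t) (mid c))
      ... | inj₁ w = inj₁ (fc-ext pt)
        where
        pt : ∀ i → i < 2 + n → fc c i ≡ fc a i
        pt i _ with i ≟ t
        ... | yes refl = trans w (sym e)
        ... | no q = h i q
      ... | inj₂ w = inj₂ (fc-ext pt)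
        where
        pt : ∀ i → i < 2 + n → fc c i ≡ fc b i
        pt i _ with i ≟ t
        ... | yes refl = trans w (sym at)
        ... | no q = trans (h i q) (sym (out i q))
    result : fc a t ≡ z₁ ⊎ fc a t ≡ z₂ → _
    result (inj₁ e) = other z₁ z₂ e z₁≢z₂ B₂ only
    result (inj₂ e) = other z₂ z₁ e (≢-sym z₁≢z₂) B₁ (λ w B → [ inj₂ , inj₁ ]′ (only w B))

  valid? : ∀ t → Dec (Valid t)
  valid? t = (0 <? t) ×-dec (t <? suc n)

  opaque
    -- The identity unless 1 ≤ t ≤ n.
    r : ℕ → X → X
    r t a with valid? t
    ... | yes v = proj₁ (flip t v a)
    ... | no _ = a

    r-same : ∀ {t i} a → i ≢ t → fc (r t a) i ≡ fc a i
    r-same {t} a i≢t with valid? t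
    ... | yes v = proj₁ (proj₂ (flip t v a)) _ i≢t
    ... | no _ = refl

    r-diff : ∀ {t} a → Valid t → fc (r t a) t ≢ fc a t
    r-diff {t} a v with valid? t
    ... | yes v′ = proj₁ (proj₂ (proj₂ (flip t v′ a)))
    ... | no ¬v = contradiction v ¬v

    r-uniq : ∀ {t a} → Valid t → ∀ c → (∀ i → i ≢ t → fc c i ≡ fc a i) → c ≡ a ⊎ c ≡ r t a
    r-uniq {t} {a} v with valid? t
    ... | yes v′ = proj₂ (proj₂ (proj₂ (flip t v′ a)))
    ... | no ¬v = contradiction v ¬v

    r-id : ∀ {t a} → ¬ Valid t → r t a ≡ a
    r-id {t} ¬v with valid? t
    ... | yes v = contradiction v ¬v
    ... | no _ = refl

  r-uniq′ : ∀ {t a} → Valid t → ∀ c → (∀ i → i ≢ t → fc c i ≡ fc a i) → fc c t ≢ fc a t → c ≡ r t a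
  r-uniq′ {t} v c h d = [ (λ e → contradiction (cong (λ a → fc a t) e) d) , id ]′ (r-uniq v c h)

  r-invol : ∀ t a → r t (r t a) ≡ a
  r-invol t a with valid? t
  ... | no ¬v = trans (r-id ¬v) (r-id ¬v)
  ... | yes v with r-uniq {t} {a} v (r t (r t a)) (λ i p → trans (r-same (r t a) p) (r-same a p))
  ...   | inj₁ e = e
  ...   | inj₂ e = contradiction (cong (λ b → fc b t) e) (r-diff (r t a) v)

  r-mid-rank : ∀ t a → Valid t → rank (fc (r t a) t) ≡ t
  r-mid-rank t a (_ , t<) = fc-rank (r t a) (m≤n⇒m≤1+n t<)

  pred≢ : ∀ {t} → 0 < t → pred t ≢ t
  pred≢ {suc t} _ e = <⇒≢ (n<1+n t) e

  pred≤ : ∀ {t} → pred t ≤ t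
  pred≤ {t} = pred[n]≤n

  -- Put the face of rank t of `r t b` into a: the result differs from a at t only, so by uniqueness
  -- it is the neighbour of a.
  r-local : ∀ {t a b} → Valid t → (∀ i → pred t ≤ i → i ≤ suc t → fc a i ≡ fc b i) → fc (r t a) t ≡ fc (r t b) t
  r-local {t} {a} {b} v@(t>0 , t≤n) h
    with replace a {t} {fc (r t b) t} v (r-mid-rank t b v)
           (subst (_⊑ fc (r t b) t) (trans (r-same b (pred≢ t>0)) (sym (h (pred t) ≤-refl (≤-trans pred≤ (n≤1+n t))))) (fc-mono (r t b) pred≤))
           (subst (fc (r t b) t ⊑_) (trans (r-same b (≢-sym (<⇒≢ (n<1+n t)))) (sym (h (suc t) (≤-trans pred≤ (n≤1+n t)) ≤-refl))) (fc-mono (r t b) (n≤1+n t)))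
  ... | c , at , out = trans (cong (λ x → fc x t) (sym c≡)) at
    where
    c≡ : c ≡ r t a
    c≡ = r-uniq′ v c out λ e → r-diff b v (trans (sym at) (trans e (h t pred≤ (n≤1+n t))))

  -- With ranks at least two apart, neither flip touches the faces that determine the other, so
  -- `r-local` applies.
  r-comm : ∀ {s t} → Valid s → Valid t → suc s < t → ∀ a → r s (r t a) ≡ r t (r s a)
  r-comm {s} {t} vs vt s+1<t a = fc-ext pt
    where
    s<t = <-trans (n<1+n s) s+1<t
    s<pred : ∀ {t} → suc s < t → s < pred t
    s<pred (s≤s p) = p
    pt : ∀ i → i < 2 + n → fc (r s (r t a)) i ≡ fc (r t (r s a)) i
    pt i _ with i ≟ s | i ≟ t
    ... | yes refl | yes refl = contradiction refl (<⇒≢ s<t)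
    ... | yes refl | no q = trans (r-local vs λ j _ j≤ → r-same a (<⇒≢ (≤-<-trans j≤ s+1<t))) (sym (r-same (r s a) q))
    ... | no q | yes refl = trans (r-same (r t a) q) (sym (r-local vt λ j ≤j _ → r-same a (≢-sym (<⇒≢ (<-≤-trans (s<pred s+1<t) ≤j)))))
    ... | no p | no q = trans (r-same (r t a) p) (trans (r-same a q) (trans (sym (r-same a p)) (sym (r-same (r s a) q))))

  -- Words in the involutions and connectedness of flags.

  act : List ℕ → X → X
  act [] a = a
  act (t ∷ w) a = act w (r t a)

  act-++ : ∀ u {v a} → act (u ++ v) a ≡ act v (act u a)
  act-++ [] = refl
  act-++ (t ∷ u) = act-++ u

  act-reverse : ∀ w a → act (reverse w) (act w a) ≡ a
  act-reverse [] a = refl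
  act-reverse (t ∷ w) a = trans (cong (λ v → act v (act w (r t a))) (unfold-reverse t w))
    (trans (act-++ (reverse w)) (trans (cong (r t) (act-reverse w (r t a))) (r-invol t a)))

  Within : ℕ → ℕ → List ℕ → Set
  Within lo hi = All (Inside lo hi)

  within-reverse : ∀ {lo hi} w → Within lo hi w → Within lo hi (reverse w)
  within-reverse [] [] = []
  within-reverse (t ∷ w) (p ∷ ps) = subst (All _) (sym (unfold-reverse t w)) (++⁺ (within-reverse w ps) (p ∷ []))

  within-mono : ∀ {lo lo′ hi hi′ w} → lo′ ≤ lo → hi ≤ hi′ → Within lo hi w → Within lo′ hi′ w
  within-mono l h = All.map λ { (p , q) → ≤-<-trans l p , <-≤-trans q h }

  act-outside : ∀ {lo hi} w {a i} → Within lo hi w → Outside lo hi i → fc (act w a) i ≡ fc a i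
  act-outside [] [] o = refl
  act-outside (t ∷ w) {a} (p ∷ ps) o = trans (act-outside w ps o) (r-same a (out≢in o p))

  Agree : ℕ → ℕ → X → X → Set
  Agree lo hi a b = ∀ i → Outside lo hi i → fc a i ≡ fc b i

  Joined : ℕ → ℕ → X → X → Set
  Joined lo hi a b = ∃[ w ] (Within lo hi w × act w a ≡ b)

  joined-trans : ∀ {lo hi a b c} → Joined lo hi a b → Joined lo hi b c → Joined lo hi a c
  joined-trans (u , U , p) (v , V , q) = u ++ v , ++⁺ U V , trans (act-++ u) (trans (cong (act v) p) q)

  joined-mono : ∀ {lo lo′ hi hi′ a b} → lo′ ≤ lo → hi ≤ hi′ → Joined lo hi a b → Joined lo′ hi′ a b
  joined-mono l h (w , W , e) = w , within-mono l h W , e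

  outside-mono : ∀ {lo lo′ hi hi′ i} → lo′ ≤ lo → hi ≤ hi′ → Outside lo′ hi′ i → Outside lo hi i
  outside-mono l h (inj₁ p) = inj₁ (≤-trans p l)
  outside-mono l h (inj₂ p) = inj₂ (≤-trans h p)

  Connected : ℕ → ℕ → Set
  Connected lo hi = ∀ a b → Agree lo hi a b → Joined lo hi a b

  -- The intermediate flag takes a below s and b above: a word inside the upper section leads to it,
  -- and a word inside the lower section leads on to b.
  share : ∀ {lo s hi} → lo ≤ s → s ≤ hi → s ≤ suc n → Connected s hi → Connected lo s →
          ∀ a b → Agree lo hi a b → fc a s ≡ fc b s → Joined lo hi a b
  share {lo} {s} {hi} lo≤s s≤hi s≤n up down a b ag e with join s a b s≤n e
  ... | c , low , high = joined-trans (joined-mono lo≤s ≤-refl (up a c ac)) (joined-mono ≤-refl s≤hi (down c b cb))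
    where
    ac : Agree s hi a c
    ac i (inj₁ p) = sym (low i p)
    ac i (inj₂ p) = trans (ag i (inj₂ p)) (sym (high i (≤-trans s≤hi p)))
    cb : Agree lo s c b
    cb i (inj₁ p) = trans (low i (≤-trans p lo≤s)) (ag i (inj₁ p))
    cb i (inj₂ p) = high i p

  opaque
    -- Consecutive faces of a chain given by strong connectivity are comparable; a flag through both
    -- is where the walk in `connect` passes from one to the other.
    through : ∀ a {lo hi H K} → lo < hi → hi ≤ suc n → Between P (fc a lo) (fc a hi) H → Between P (fc a lo) (fc a hi) K →
              H ⊑ K → ∃[ c ] (fc c (rank H) ≡ H × fc c (rank K) ≡ K × Agree lo hi c a)
    through a {lo} {hi} {H} {K} lo<hi hi≤ BH BK H⊑K
      with between-rank a lo<hi (s≤s hi≤) BH | between-rank a lo<hi (s≤s hi≤) BK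
    ... | h₁ , h₂ | k₁ , k₂ with insert a h₁ h₂ hi≤ refl (proj₁ (proj₁ BH)) (proj₁ (proj₂ BH))
    ...   | c , cH , c-out with m≤n⇒m<n∨m≡n (rank-≤ H⊑K)
    ...     | inj₂ e = c , cH , subst (λ Z → fc c (rank Z) ≡ Z) (⊑-rank-≡ H⊑K e) cH , c-out
    ...     | inj₁ l with insert c l k₂ hi≤ refl (subst (_⊑ K) (sym cH) H⊑K) (subst (K ⊑_) (sym (c-out hi (inj₂ ≤-refl))) (proj₁ (proj₂ BK)))
    ...       | d , dK , d-out = d , trans (d-out (rank H) (inj₁ ≤-refl)) cH , dK ,
                  λ i o → trans (d-out i (outside-mono (<⇒≤ h₁) ≤-refl o)) (c-out i o)

  -- Strong connectivity speaks of faces; flags follow by induction, `d` bounding the rank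
  -- difference. With a difference of at most one nothing can change, and with two the diamond
  -- leaves a single flip. Otherwise a chain of faces is walked, and flags sharing a face of it are
  -- joined by `share` inside two smaller sections.
  connect : ∀ d lo hi → hi ≤ d + lo → hi ≤ suc n → Connected lo hi
  connect d lo hi hi≤d hi≤n a b ag with hi ≤? suc lo
  ... | yes p = [] , [] , fc-ext (λ i _ → ag i (out i))
    where
    out : ∀ i → Outside lo hi i
    out i with i ≤? lo
    ... | yes q = inj₁ q
    ... | no q = inj₂ (≤-trans p (≰⇒> q))
  connect zero lo hi hi≤d hi≤n a b ag | no ¬p = contradiction (≤-trans hi≤d (n≤1+n lo)) ¬p
  connect (suc d) lo hi hi≤d hi≤n a b ag | no ¬p with hi ≤? 2 + lo
  ... | yes p with ≤-antisym p (≰⇒> ¬p)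
  ...   | refl with r-uniq {suc lo} {a} (z<s , hi≤n) b (λ i i≢ → sym (ag i (outside i i≢)))
    where
    outside : ∀ i → i ≢ suc lo → Outside lo hi i
    outside i i≢ with <-cmp i (suc lo)
    ... | tri< l _ _ = inj₁ (≤-pred l)
    ... | tri≈ _ e _ = contradiction e i≢
    ... | tri> _ _ l = inj₂ l
  ...     | inj₁ e = [] , [] , sym e
  ...     | inj₂ e = [ suc lo ] , (n<1+n lo , n<1+n (suc lo)) ∷ [] , sym e
  connect (suc d) lo hi hi≤d hi≤n a b ag | no ¬p | no ¬q =
    walk (strongly-connected (fc-mono a (<⇒≤ lo<hi))
           (subst₂ (λ i j → 3 + i ≤ j) (sym (fc-rank a (<-trans lo<hi (s≤s hi≤n)))) (sym (fc-rank a (s≤s hi≤n))) (≰⇒> ¬q))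
           (fc a (suc lo)) (fc b (suc lo))
           (fc-between a (n<1+n lo) (≰⇒> ¬p) (s≤s hi≤n))
           (subst₂ (λ x y → Between P x y (fc b (suc lo))) (sym (ag lo (inj₁ ≤-refl))) (sym (ag hi (inj₂ ≤-refl)))
             (fc-between b (n<1+n lo) (≰⇒> ¬p) (s≤s hi≤n))))
         a b (λ _ _ → refl) (λ i o → sym (ag i o)) (cong (fc a) (fc-rank a slo<)) (cong (fc b) (fc-rank b slo<))
         (fc-between a (n<1+n lo) (≰⇒> ¬p) (s≤s hi≤n))
    where
    lo<hi : lo < hi
    lo<hi = <-trans (n<1+n lo) (≰⇒> ¬p)
    slo< : suc lo < 2 + n
    slo< = <-trans (≰⇒> ¬p) (s≤s hi≤n)
    shareAt : ∀ {H} a′ b′ → Agree lo hi a′ a → Agree lo hi b′ a → fc a′ (rank H) ≡ H → fc b′ (rank H) ≡ H →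
              Between P (fc a lo) (fc a hi) H → Joined lo hi a′ b′
    shareAt {H} a′ b′ ea eb ha hb B with between-rank a lo<hi (s≤s hi≤n) B
    ... | p , q = share (<⇒≤ p) (<⇒≤ q) (≤-trans (<⇒≤ q) hi≤n)
          (connect d (rank H) hi (≤-trans hi≤d (subst (_≤ d + rank H) (+-suc d lo) (+-monoʳ-≤ d p))) hi≤n)
          (connect d lo (rank H) (≤-pred (≤-trans q hi≤d)) (≤-trans (<⇒≤ q) hi≤n))
          a′ b′ (λ i o → trans (ea i o) (sym (eb i o))) (trans ha (sym hb))
    walk : ∀ {H K} → Star (CompStep P (fc a lo) (fc a hi)) H K → ∀ a′ b′ → Agree lo hi a′ a → Agree lo hi b′ a →
           fc a′ (rank H) ≡ H → fc b′ (rank K) ≡ K → Between P (fc a lo) (fc a hi) H → Joined lo hi a′ b′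
    walk ε a′ b′ ea eb ha hb B = shareAt a′ b′ ea eb ha hb B
    walk ((BH , BK , inj₁ H⊑K) ◅ rest) a′ b′ ea eb ha hb B with through a lo<hi hi≤n BH BK H⊑K
    ... | c , cH , cK , ec = joined-trans (shareAt a′ c ea ec ha cH B) (walk rest c b′ ec eb cK hb BK)
    walk ((BH , BK , inj₂ K⊑H) ◅ rest) a′ b′ ea eb ha hb B with through a lo<hi hi≤n BK BH K⊑H
    ... | c , cK , cH , ec = joined-trans (shareAt a′ c ea ec ha cH B) (walk rest c b′ ec eb cK hb BK)

  opaque
    connected : ∀ lo hi → hi ≤ suc n → Connected lo hi
    connected lo hi = connect hi lo hi (m≤m+n hi lo)

-- Orbits of flags and closed words.

module _ {n : ℕ} {P : GradedPoset n} where

  orbit-sym : ∀ {Φ Ψ} → SameOrbit P Φ Ψ → SameOrbit P Ψ Φ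
  orbit-sym (φ , h) = record
    { fun = inv ; inv = fun ; inv-fun = fun-inv ; fun-inv = inv-fun
    ; fun-mono = λ {x} {y} p → fun-refl (subst₂ (GradedPoset._≤_ P) (sym (fun-inv x)) (sym (fun-inv y)) p)
    ; fun-refl = λ {x} {y} p → subst₂ (GradedPoset._≤_ P) (fun-inv x) (fun-inv y) (fun-mono p) } ,
    λ i → trans (cong inv (sym (h i))) (inv-fun _)
    where open Automorphism φ

  orbit-trans : ∀ {Φ Ψ Χ} → SameOrbit P Φ Ψ → SameOrbit P Ψ Χ → SameOrbit P Φ Χ
  orbit-trans (φ , h) (ψ , k) = record
    { fun = B.fun ∘ A.fun ; inv = A.inv ∘ B.inv
    ; inv-fun = λ x → trans (cong A.inv (B.inv-fun _)) (A.inv-fun x)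
    ; fun-inv = λ x → trans (cong B.fun (A.fun-inv _)) (B.fun-inv x)
    ; fun-mono = B.fun-mono ∘ A.fun-mono
    ; fun-refl = A.fun-refl ∘ B.fun-refl } ,
    λ i → trans (cong B.fun (h i)) (k i)
    where
    module A = Automorphism φ
    module B = Automorphism ψ

module Orbits {n : ℕ} (P : GradedPoset n) (isP : IsPolytope P) {N : ℕ} (count : HasFlagCount P N) where

  open Flags P isP count
  open Seq

  infix 4 _~_

  _~_ : X → X → Set
  a ~ b = SameOrbit P (flag a) (flag b)

  -- The flags a and b range over all of `P`, so this concerns all sections between faces of ranks
  -- `lo` and `hi` at once. In the shifted ranks of a 4-polytope, `Reg 0 4` is about facets and
  -- `Reg 1 5` about vertex-figures.
  Reg : ℕ → ℕ → Set
  Reg lo hi = ∀ w → Within lo hi w → ∀ a b → act w a ≡ a → act w b ≡ b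

  reg-mono : ∀ {lo lo′ hi hi′} → lo ≤ lo′ → hi′ ≤ hi → Reg lo hi → Reg lo′ hi′
  reg-mono l h reg w W = reg w (within-mono l h W)

  reg-≡ : ∀ {lo hi} → Reg lo hi → ∀ u v → Within lo hi u → Within lo hi v →
          ∀ a b → act u a ≡ act v a → act u b ≡ act v b
  reg-≡ reg u v U V a b e = begin
    act u b                              ≡⟨ act-reverse (reverse v) (act u b) ⟨
    act (reverse (reverse v)) (act (reverse v) (act u b)) ≡⟨ cong (act (reverse (reverse v))) (trans (sym (act-++ u)) closed) ⟩
    act (reverse (reverse v)) b          ≡⟨ cong (act (reverse (reverse v))) (sym (act-reverse v b)) ⟩
    act (reverse (reverse v)) (act (reverse v) (act v b)) ≡⟨ act-reverse (reverse v) (act v b) ⟩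
    act v b                              ∎
    where
    open ≡-Reasoning
    closed : act (u ++ reverse v) b ≡ b
    closed = reg (u ++ reverse v) (++⁺ U (within-reverse v V)) a b
      (trans (act-++ u) (trans (cong (act (reverse v)) e) (act-reverse v a)))

  -- A relation replaces a map so that one argument covers both automorphisms of `P` and
  -- automorphisms of a section, which act on only part of the faces of `P`.
  module Transport
    (R : Face → Face → Set)
    (R-mono : ∀ {u u′ v v′} → R u u′ → R v v′ → u ⊑ v → u′ ⊑ v′)
    (R-inj : ∀ {u u′ v v′} → R u u′ → R v v′ → u′ ≡ v′ → u ≡ v)
    (R-fun : ∀ {u u′ u″} → R u u′ → R u u″ → u′ ≡ u″)
    (R-total : ∀ {v v′ w w′ u} → R v v′ → R w w′ → v ⊑ u → u ⊑ w → ∃[ u′ ] R u u′)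
    {lo hi : ℕ} (hi≤ : hi ≤ suc n) where

    Rel : X → X → Set
    Rel a b = ∀ i → lo ≤ i → i ≤ hi → R (fc a i) (fc b i)

    -- By monotonicity and injectivity the image of the flipped face lies strictly between the right
    -- two faces of b and differs from the image of the old face; uniqueness of the neighbour leaves
    -- only `r t b`.
    rel-r : ∀ {t a b} → Inside lo hi t → Rel a b → Rel (r t a) (r t b)
    rel-r {suc s} {a} {b} (s≤s lo≤s , t<hi) rel = go (R-total lower′ upper′ below above)
      where
      t = suc s
      v : Valid t
      v = z<s , <-≤-trans t<hi hi≤
      a′ = r t a
      s≢t : s ≢ t
      s≢t = <⇒≢ (n<1+n s)
      st≢t : suc t ≢ t
      st≢t = ≢-sym (<⇒≢ (n<1+n t))
      lower′ : R (fc a s) (fc b s)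
      lower′ = rel s lo≤s (<⇒≤ (<-trans (n<1+n s) t<hi))
      upper′ : R (fc a (suc t)) (fc b (suc t))
      upper′ = rel (suc t) (≤-trans lo≤s (≤-trans (n≤1+n s) (n≤1+n t))) t<hi
      between : Between P (fc a s) (fc a (suc t)) (fc a′ t)
      between = subst₂ (λ x y → Between P x y (fc a′ t)) (r-same a s≢t) (r-same a st≢t)
        (fc-between a′ (n<1+n s) (n<1+n t) (s≤s (≤-trans t<hi hi≤)))
      below = proj₁ (proj₁ between)
      above = proj₁ (proj₂ between)
      go : ∃[ u ] R (fc a′ t) u → Rel (r t a) (r t b)
      go (u , Ru) with between-rank b (<-trans (n<1+n s) (n<1+n t)) (s≤s (≤-trans t<hi hi≤))
           ((R-mono lower′ Ru below , proj₂ (proj₁ between) ∘ R-inj lower′ Ru) , (R-mono Ru upper′ above , proj₂ (proj₂ between) ∘ R-inj Ru upper′))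
      ... | s<u , u<t with replace b v (≤-antisym (≤-pred u<t) s<u) (R-mono lower′ Ru below) (R-mono Ru upper′ above)
      ...   | c , at , out = λ i p q → pointwise i p q (i ≟ t)
        where
        c≡ : c ≡ r t b
        c≡ = r-uniq′ v c out λ e → r-diff a v
          (R-inj Ru (rel t (≤-trans lo≤s (n≤1+n s)) (<⇒≤ t<hi)) (trans (sym at) e))
        pointwise : ∀ i → lo ≤ i → i ≤ hi → Dec (i ≡ t) → R (fc (r t a) i) (fc (r t b) i)
        pointwise i p q (yes refl) = subst (R (fc a′ t)) (trans (sym at) (cong (λ x → fc x t) c≡)) Ru
        pointwise i p q (no i≢t) = subst₂ R (sym (r-same a i≢t)) (sym (r-same b i≢t)) (rel i p q)

    rel-act : ∀ w {a b} → Within lo hi w → Rel a b → Rel (act w a) (act w b)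
    rel-act [] [] rel = rel
    rel-act (t ∷ w) (p ∷ ps) rel = rel-act w ps (rel-r p rel)

    rel-closed : ∀ w {a b} → Within lo hi w → Rel a b → act w a ≡ a → act w b ≡ b
    rel-closed w {a} {b} W rel e = fc-ext λ i _ → pointwise i (i ≤? lo) (hi ≤? i)
      where
      pointwise : ∀ i → Dec (i ≤ lo) → Dec (hi ≤ i) → fc (act w b) i ≡ fc b i
      pointwise i (yes p) _ = act-outside w W (inj₁ p)
      pointwise i (no _) (yes q) = act-outside w W (inj₂ q)
      pointwise i (no p) (no q) = R-fun (subst (λ c → R (fc c i) _) e (rel-act w W rel i lo≤i i≤hi)) (rel i lo≤i i≤hi)
        where
        lo≤i = <⇒≤ (≰⇒> p)
        i≤hi = <⇒≤ (≰⇒> q)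

  orbit-fc : ∀ {a b} → ((φ , _) : a ~ b) → ∀ {i} → i < 2 + n → Automorphism.fun φ (fc a i) ≡ fc b i
  orbit-fc {a} {b} (φ , h) {i} p =
    subst (λ k → Automorphism.fun φ (fc a k) ≡ fc b k) (toℕ-fromℕ< p)
      (subst₂ (λ x y → Automorphism.fun φ x ≡ y) (fc-flag a j) (fc-flag b j) (h j))
    where j = fromℕ< p

  ~-closed : ∀ {a b} → a ~ b → ∀ w → Within 0 (suc n) w → act w a ≡ a → act w b ≡ b
  ~-closed {a} {b} s@(φ , _) w W = rel-closed w W (λ i _ p → orbit-fc s (s≤s p))
    where
    open Automorphism φ
    R : Face → Face → Set
    R u u′ = fun u ≡ u′
    mono : ∀ {u u′ v v′} → R u u′ → R v v′ → u ⊑ v → u′ ⊑ v′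
    mono refl refl p = fun-mono p
    inj : ∀ {u u′ v v′} → R u u′ → R v v′ → u′ ≡ v′ → u ≡ v
    inj {u} {_} {v} refl refl e = trans (sym (inv-fun u)) (trans (cong inv e) (inv-fun v))
    functional : ∀ {u u′ u″} → R u u′ → R u u″ → u′ ≡ u″
    functional refl refl = refl
    total : ∀ {v v′ w w′ u} → R v v′ → R w w′ → v ⊑ u → u ⊑ w → ∃[ u′ ] R u u′
    total _ _ _ _ = _ , refl
    open Transport R mono inj functional total {0} {suc n} ≤-refl

  adjacent : ∀ {t} → Valid t → ∀ a → Adjacent P (flag a) (flag (r t a))
  adjacent {t} v@(_ , t<) a = i ,
    (λ e → r-diff a v (trans (sym (at (r t a))) (trans (sym e) (at a)))) ,
    λ j j≢i → trans (fc-flag a j) (trans (sym (r-same a λ e → j≢i (toℕ-injective (trans e (sym ti))))) (sym (fc-flag (r t a) j)))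
    where
    i = fromℕ< (<-trans t< (n<1+n (suc n)))
    ti : toℕ i ≡ t
    ti = toℕ-fromℕ< _
    at : ∀ b → face (flag b) i ≡ fc b t
    at b = trans (fc-flag b i) (cong (fc b) ti)

  opaque
    complete : ∀ {x y} → x ⊑ y → ∃[ a ] (fc a (rank x) ≡ x × fc a (rank y) ≡ y)
    complete {x} {y} p with m≤n⇒m<n∨m≡n (rank-≤ p)
    ... | inj₂ e = a , ax , subst (λ z → fc a (rank z) ≡ z) (⊑-rank-≡ p e) ax
      where
      at : ∀ x → ∃[ a ] fc a (rank x) ≡ x
      at x with lower x | upper x
      ... | f , F , fx | g , G , gx = mk S , trans (fc-mk S (rank-≤top x)) (trans (cat-≥ {s = rank x} ≤-refl) gx)
        where
        S : Seq 0 (2 + n) (cat (rank x) f g)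
        S = cat-seq (seq-weaken z≤n (n≤1+n _) F) G λ i e _ _ →
          subst (f i ⊑_) (trans (cong f e) (trans fx (sym gx))) (st F i z≤n (s≤s (≤-reflexive e)))
      a : X
      a = proj₁ (at x)
      ax : fc a (rank x) ≡ x
      ax = proj₂ (at x)
    ... | inj₁ x<y with lower x | saturate (rank y) x y p x<y (m≤m+n _ _) | upper y
    ...   | f , F , fx | m , M , mx , my | g , G , gy = mk S ,
        trans (fc-mk S (rank-≤top x)) (trans (cat-≥ {s = rank x} ≤-refl) mx′) ,
        trans (fc-mk S (rank-≤top y)) (trans (cat-≥ (<⇒≤ x<y)) (trans (cat-≥ {s = rank y} ≤-refl) gy))
      where
      mx′ : cat (rank y) m g (rank x) ≡ x
      mx′ = trans (cat-< x<y) mx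
      S : Seq 0 (2 + n) (cat (rank x) f (cat (rank y) m g))
      S = cat-seq (seq-weaken z≤n (n≤1+n _) F)
        (cat-seq (seq-weaken ≤-refl (n≤1+n _) M) G λ i e l _ →
          subst (m i ⊑_) (trans (cong m e) (trans my (sym gy))) (st M i l (s≤s (≤-reflexive e))))
        λ i e _ _ → subst (f i ⊑_) (trans (cong f e) (trans fx (sym mx′))) (st F i z≤n (s≤s (≤-reflexive e)))

  flagAt : ∀ x → ∃[ a ] fc a (rank x) ≡ x
  flagAt x with complete (⊑-refl x)
  ... | a , e , _ = a , e

  module Extend (reg : Reg 0 (suc n)) where

    ends : ∀ a b → Agree 0 (suc n) a b
    ends a b i (inj₁ z≤n) = ⊑-rank-≡ₒ
      where
      bot : ∀ c → bottom ≡ fc c 0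
      bot c = ⊑-rank-≡ (bottom-least _) (trans rank-bottom (sym (fc-rank c z<s)))
      ⊑-rank-≡ₒ : fc a 0 ≡ fc b 0
      ⊑-rank-≡ₒ = trans (sym (bot a)) (bot b)
    ends a b i (inj₂ p) = trans (tops a) (sym (tops b))
      where
      last : ∀ c → fc c (suc n) ≡ top
      last c = ⊑-rank-≡ (top-greatest _) (trans (fc-rank c ≤-refl) (sym rank-top))
      tops : ∀ c → fc c i ≡ top
      tops c with m≤n⇒m<n∨m≡n p
      ... | inj₁ q = trans (fc-over c q) (last c)
      ... | inj₂ refl = last c

    path : ∀ a b → Joined 0 (suc n) a b
    path a b = connected 0 (suc n) ≤-refl a b (ends a b)

    -- Follows from `a₁` a word that leads from `a₀` to a. The word is a choice, but `reg` makes the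
    -- result depend only on its endpoints, which gives equivariance.
    g : X → X → X → X
    g a₀ a₁ a = act (proj₁ (path a₀ a)) a₁

    g-act : ∀ {a₀ a₁} w {a} → Within 0 (suc n) w → g a₀ a₁ (act w a) ≡ act w (g a₀ a₁ a)
    g-act {a₀} {a₁} w {a} W with path a₀ a | path a₀ (act w a)
    ... | u , U , e | v , V , e′ = trans
      (reg-≡ reg v (u ++ w) V (++⁺ U W) a₀ a₁ (trans e′ (sym (trans (act-++ u) (cong (act w) e)))))
      (act-++ u)

    g-inverse : ∀ a₀ a₁ a → g a₁ a₀ (g a₀ a₁ a) ≡ a
    g-inverse a₀ a₁ a with path a₀ a
    ... | u , U , e with path a₁ (act u a₁)
    ...   | v , V , e′ = trans (reg-≡ reg v u V U a₁ a₀ e′) e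

    g-base : ∀ a₀ a₁ → g a₀ a₁ a₀ ≡ a₁
    g-base a₀ a₁ with path a₀ a₀
    ... | u , U , e = reg u U a₀ a₁ e

    -- Flags with a common face of rank i are joined by a word above i followed by one below i.
    -- Neither moves that face, and by equivariance the same words join the images; hence the map
    -- descends from flags to faces.
    g-face : ∀ {a₀ a₁ i a b} → i < 2 + n → fc a i ≡ fc b i → fc (g a₀ a₁ a) i ≡ fc (g a₀ a₁ b) i
    g-face {a₀} {a₁} {i} {a} {b} (s≤s i≤) e with join i a b i≤ e
    ... | c , low , high with connected i (suc n) ≤-refl a c ac | connected 0 i i≤ c b cb
      where
      ac : Agree i (suc n) a c
      ac j (inj₁ p) = sym (low j p)
      ac j (inj₂ p) = trans (ends a b j (inj₂ p)) (sym (high j (≤-trans i≤ p)))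
      cb : Agree 0 i c b
      cb j (inj₁ p) = trans (low j (≤-trans p z≤n)) (ends a b j (inj₁ p))
      cb j (inj₂ p) = high j p
    ...   | u , U , refl | v , V , refl = sym (begin
      fc (g a₀ a₁ (act v (act u a))) i ≡⟨ cong (λ x → fc x i) (g-act v (within-mono z≤n i≤ V)) ⟩
      fc (act v (g a₀ a₁ (act u a))) i ≡⟨ act-outside v V (inj₂ ≤-refl) ⟩
      fc (g a₀ a₁ (act u a)) i         ≡⟨ cong (λ x → fc x i) (g-act u (within-mono z≤n ≤-refl U)) ⟩
      fc (act u (g a₀ a₁ a)) i         ≡⟨ act-outside u U (inj₁ ≤-refl) ⟩
      fc (g a₀ a₁ a) i                 ∎)
      where open ≡-Reasoning

    F : X → X → Face → Face
    F a₀ a₁ x = fc (g a₀ a₁ (proj₁ (flagAt x))) (rank x)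

    F-fc : ∀ {a₀ a₁} a {i} → i < 2 + n → F a₀ a₁ (fc a i) ≡ fc (g a₀ a₁ a) i
    F-fc {a₀} {a₁} a {i} p = trans (cong (fc (g a₀ a₁ b)) (fc-rank a p))
      (g-face p (trans (cong (fc b) (sym (fc-rank a p))) (proj₂ (flagAt (fc a i)))))
      where
      b : X
      b = proj₁ (flagAt (fc a i))

    F-inverse : ∀ a₀ a₁ x → F a₁ a₀ (F a₀ a₁ x) ≡ x
    F-inverse a₀ a₁ x = trans (F-fc (g a₀ a₁ (proj₁ (flagAt x))) (rank-≤top x))
      (trans (cong (λ a → fc a (rank x)) (g-inverse a₀ a₁ _)) (proj₂ (flagAt x)))

    F-mono : ∀ a₀ a₁ {x y} → x ⊑ y → F a₀ a₁ x ⊑ F a₀ a₁ y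
    F-mono a₀ a₁ {x} {y} p with complete p
    ... | a , ax , ay = subst₂ _⊑_ (image x ax) (image y ay) (fc-mono (g a₀ a₁ a) (rank-≤ p))
      where
      image : ∀ z → fc a (rank z) ≡ z → fc (g a₀ a₁ a) (rank z) ≡ F a₀ a₁ z
      image z e = trans (sym (F-fc a (rank-≤top z))) (cong (F a₀ a₁) e)

    all-equivalent : ∀ a₀ a₁ → a₀ ~ a₁
    all-equivalent a₀ a₁ = record
      { fun = F a₀ a₁ ; inv = F a₁ a₀ ; inv-fun = F-inverse a₀ a₁ ; fun-inv = F-inverse a₁ a₀
      ; fun-mono = F-mono a₀ a₁
      ; fun-refl = λ p → subst₂ _⊑_ (F-inverse a₀ a₁ _) (F-inverse a₀ a₁ _) (F-mono a₁ a₀ p) } ,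
      λ i → trans (cong (F a₀ a₁) (fc-flag a₀ i)) (trans (F-fc a₀ (toℕ<n i))
        (trans (cong (λ a → fc a (toℕ i)) (g-base a₀ a₁)) (sym (fc-flag a₁ i))))

-- Closed words in a chiral polytope.

module Chirality {n : ℕ} (P : GradedPoset n) (isP : IsPolytope P) {N : ℕ} (count : HasFlagCount P N) (ch : Chiral P) where

  open Flags P isP count
  open Orbits P isP count

  -- Adjacent flags lie in different orbits and there are only two, so a and its neighbour represent
  -- both.
  dichotomy : ∀ {t} → Valid t → ∀ a b → a ~ b ⊎ r t a ~ b
  dichotomy {t} v a b with proj₁ ch
  ... | Φ , Ψ , _ , split = go (split (flag a)) (split (flag (r t a))) (split (flag b))
    where
    via : ∀ Φ x y → SameOrbit P Φ (flag x) → SameOrbit P Φ (flag y) → x ~ y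
    via Φ x y p q = orbit-trans {P = P} {flag x} {Φ} {flag y} (orbit-sym {P = P} {Φ} {flag x} p) q
    odd : ¬ (a ~ r t a)
    odd = proj₂ ch (flag a) (flag (r t a)) (adjacent v a)
    a′ : X
    a′ = r t a
    go : SameOrbit P Φ (flag a) ⊎ SameOrbit P Ψ (flag a) →
         SameOrbit P Φ (flag a′) ⊎ SameOrbit P Ψ (flag a′) →
         SameOrbit P Φ (flag b) ⊎ SameOrbit P Ψ (flag b) → a ~ b ⊎ a′ ~ b
    go (inj₁ p) _ (inj₁ q) = inj₁ (via Φ a b p q)
    go (inj₂ p) _ (inj₂ q) = inj₁ (via Ψ a b p q)
    go _ (inj₁ p) (inj₁ q) = inj₂ (via Φ a′ b p q)
    go _ (inj₂ p) (inj₂ q) = inj₂ (via Ψ a′ b p q)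
    go (inj₁ p) (inj₁ q) (inj₂ _) = ⊥-elim (odd (via Φ a a′ p q))
    go (inj₂ p) (inj₂ q) (inj₁ _) = ⊥-elim (odd (via Ψ a a′ p q))

  closed-spreads : ∀ {t} → Valid t → ∀ w → Within 0 (suc n) w → ∀ a →
                   act w a ≡ a → act w (r t a) ≡ r t a → ∀ b → act w b ≡ b
  closed-spreads {t} v w W a e e′ b with dichotomy v a b
  ... | inj₁ s = ~-closed {a} {b} s w W e
  ... | inj₂ s = ~-closed {r t a} {b} s w W e′

  -- One flag and one neighbour suffice, as they represent both orbits. A relation found at a flag
  -- in the orbit of the neighbour is conjugated by t, which moves it to the orbit of `a₀`.
  reg-from : ∀ {lo hi t} → hi ≤ suc n → Inside lo hi t → ∀ a₀ →
             (∀ w → Within lo hi w → act w a₀ ≡ a₀ → act w (r t a₀) ≡ r t a₀) → Reg lo hi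
  reg-from {lo} {hi} {t} hi≤ inside@(p , q) a₀ half w W a b e = result (dichotomy v a a₀)
    where
    v : Valid t
    v = ≤-<-trans z≤n p , <-≤-trans q hi≤
    spread : ∀ w → Within lo hi w → act w a₀ ≡ a₀ → ∀ b → act w b ≡ b
    spread w W e = closed-spreads v w (within-mono z≤n hi≤ W) a₀ e (half w W e)
    result : a ~ a₀ ⊎ r t a ~ a₀ → act w b ≡ b
    result (inj₁ s) = spread w W (~-closed {a} {a₀} s w (within-mono z≤n hi≤ W) e) b
    result (inj₂ s) = begin
      act w b                       ≡⟨ r-invol t (act w b) ⟨
      r t (r t (act w b))           ≡⟨ cong (r t) (trans (cong (r t ∘ act w) (sym (r-invol t b))) (sym (conj (r t b)))) ⟩
      r t (act w′ (r t b))          ≡⟨ cong (r t) (spread w′ W′ closed (r t b)) ⟩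
      r t (r t b)                   ≡⟨ r-invol t b ⟩
      b                             ∎
      where
      open ≡-Reasoning
      w′ = t ∷ w ++ [ t ]
      W′ : Within lo hi w′
      W′ = inside ∷ ++⁺ W (inside ∷ [])
      conj : ∀ c → act w′ c ≡ r t (act w (r t c))
      conj c = act-++ w
      closed : act w′ a₀ ≡ a₀
      closed = ~-closed {r t a} {a₀} s w′ (within-mono z≤n hi≤ W′)
        (trans (conj (r t a)) (cong (r t) (trans (cong (act w) (r-invol t a)) e)))

  -- Commuting with `r t` carries a closed word from a to its neighbour across t, which lies in the
  -- other orbit.
  reg-commuting : ∀ {lo hi t} → hi ≤ suc n → Valid t → (∀ s → Inside lo hi s → suc s < t ⊎ suc t < s) → Reg lo hi
  reg-commuting {lo} {hi} {t} hi≤ v far w W a b e =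
    closed-spreads v w W′ a e (trans (comm w W W′ a) (cong (r t) e)) b
    where
    W′ : Within 0 (suc n) w
    W′ = within-mono z≤n hi≤ W
    comm : ∀ w → Within lo hi w → Within 0 (suc n) w → ∀ a → act w (r t a) ≡ r t (act w a)
    comm [] _ _ a = refl
    comm (s ∷ w) (p ∷ ps) (q ∷ qs) a with far s p
    ... | inj₁ l = trans (cong (act w) (r-comm q v l a)) (comm w ps qs (r s a))
    ... | inj₂ l = trans (cong (act w) (sym (r-comm v q l a))) (comm w ps qs (r s a))

  ¬Reg-all : 0 < n → X → ¬ Reg 0 (suc n)
  ¬Reg-all 0<n a reg = proj₂ ch (flag a) (flag (r 1 a)) (adjacent (z<s , s≤s 0<n) a)
    (Extend.all-equivalent reg a (r 1 a))

  -- Sections of a chiral polytope.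

  module Sections {x y : Face} {lo k : ℕ} (x⊑y : x ⊑ y) (rx : rank x ≡ lo) (ry : rank y ≡ lo + suc k) (0<k : 0 < k) where

    S : GradedPoset k
    S = Section P x y k

    hi : ℕ
    hi = lo + suc k

    hi≤ : hi ≤ suc n
    hi≤ = ≤-pred (subst (_< 2 + n) ry (rank-≤top y))

    lo<hi : lo < hi
    lo<hi = m<m+n lo z<s

    a₀ : X
    a₀ = proj₁ (complete x⊑y)

    a₀-x : fc a₀ lo ≡ x
    a₀-x = trans (cong (fc a₀) (sym rx)) (proj₁ (proj₂ (complete x⊑y)))

    a₀-y : fc a₀ hi ≡ y
    a₀-y = trans (cong (fc a₀) (sym ry)) (proj₂ (proj₂ (complete x⊑y)))

    S-≡ : {u v : GradedPoset.Face S} → proj₁ u ≡ proj₁ v → u ≡ v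
    S-≡ {H , p , q} {.H , p′ , q′} refl with ⊑-irrelevant p p′ | ⊑-irrelevant q q′
    ... | refl | refl = refl

    under : Flag S → Fin (2 + k) → Face
    under Φ i = proj₁ (face Φ i)

    S-rank : ∀ (Φ : Flag S) i → rank (under Φ i) ≡ lo + toℕ i
    S-rank Φ i = begin
      rank H                    ≡⟨ m+[n∸m]≡n (rank-≤ (proj₁ (proj₂ (face Φ i)))) ⟨
      rank x + (rank H ∸ rank x) ≡⟨ cong₂ _+_ rx (rank-ok Φ i) ⟩
      lo + toℕ i                ∎
      where
      open ≡-Reasoning
      H = under Φ i

    S-first : ∀ (Φ : Flag S) i → toℕ i ≡ 0 → under Φ i ≡ x
    S-first Φ i e = sym (⊑-rank-≡ (proj₁ (proj₂ (face Φ i)))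
      (trans rx (sym (trans (S-rank Φ i) (trans (cong (lo +_) e) (+-identityʳ lo))))))

    S-last : ∀ (Φ : Flag S) i → toℕ i ≡ suc k → under Φ i ≡ y
    S-last Φ i e = ⊑-rank-≡ (proj₂ (proj₂ (face Φ i))) (trans (S-rank Φ i) (trans (cong (lo +_) e) (sym ry)))

    Lifts : X → Flag S → Set
    Lifts a Φ = ∀ i → fc a (lo + toℕ i) ≡ under Φ i

    position : ∀ (i : ℕ) → lo ≤ i → i ≤ hi → ∃[ j ] lo + toℕ {2 + k} j ≡ i
    position i p q = fromℕ< (s≤s (m≤n+o⇒m∸n≤o i lo q)) ,
      trans (cong (lo +_) (toℕ-fromℕ< _)) (m+[n∸m]≡n p)

    lifts-x : ∀ {a} Φ → Lifts a Φ → fc a lo ≡ x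
    lifts-x {a} Φ l = trans (cong (fc a) (sym (+-identityʳ lo))) (trans (l Fin.zero) (S-first Φ Fin.zero refl))

    lifts-y : ∀ {a} Φ → Lifts a Φ → fc a hi ≡ y
    lifts-y {a} Φ l = trans (cong (fc a) (sym (cong (lo +_) e))) (trans (l i) (S-last Φ i e))
      where
      i : Fin (2 + k)
      i = fromℕ< (n<1+n (suc k))
      e : toℕ i ≡ suc k
      e = toℕ-fromℕ< (n<1+n (suc k))

    opaque
      -- All flags of the section are completed by the same outer faces of `a₀`, so adjacent flags
      -- of the section lift to adjacent flags of `P`.
      lift : ∀ Φ → ∃[ a ] (Lifts a Φ × (∀ i → Outside lo hi i → fc a i ≡ fc a₀ i))
      lift Φ = a , lifts , outside
        where
        pos : ℕ → Fin (2 + k)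
        pos i = fromℕ< (s≤s (m⊓n≤n (i ∸ lo) (suc k)))
        f : ℕ → Face
        f i = under Φ (pos i)
        pos-≡ : ∀ i → lo ≤ i → i < suc hi → lo + toℕ (pos i) ≡ i
        pos-≡ i p q = trans (cong (lo +_) (trans (toℕ-fromℕ< _) (m≤n⇒m⊓n≡m (m≤n+o⇒m∸n≤o i lo (≤-pred q))))) (m+[n∸m]≡n p)
        F : Seq lo (suc hi) f
        F = seq (λ i p q → trans (S-rank Φ (pos i)) (pos-≡ i p q))
          λ i p q → chain Φ (pos i) (pos (suc i)) (subst₂ _≤_ (sym (toℕ-fromℕ< _)) (sym (toℕ-fromℕ< _))
            (⊓-monoˡ-≤ (suc k) (∸-monoˡ-≤ lo (n≤1+n i))))
        G : Seq lo (2 + n) (cat (suc hi) f (fc a₀))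
        G = cat-seq F (seq-weaken z≤n ≤-refl (fc-seq a₀)) λ { i refl _ _ →
          ⊑-trans (proj₂ (proj₂ (face Φ (pos i)))) (subst (_⊑ fc a₀ (suc i)) a₀-y (fc-mono a₀ (n≤1+n i))) }
        E : Seq 0 (2 + n) (cat lo (fc a₀) (cat (suc hi) f (fc a₀)))
        E = cat-seq (seq-weaken z≤n (m≤n⇒m≤1+n (≤-trans (<⇒≤ lo<hi) hi≤)) (fc-seq a₀)) G λ { i e _ _ →
          ⊑-trans (subst (fc a₀ i ⊑_) a₀-x (fc-mono a₀ (<⇒≤ (≤-reflexive e))))
            (subst (x ⊑_) (sym (cat-< (m≤n⇒m≤1+n lo<hi))) (proj₁ (proj₂ (face Φ (pos lo))))) }
        a : X
        a = mk E
        lifts : Lifts a Φ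
        lifts j = trans (fc-mk E (≤-<-trans i≤hi (s≤s hi≤))) (trans (cat-≥ (m≤m+n lo (toℕ j)))
          (trans (cat-< (s≤s i≤hi)) (cong (under Φ) (toℕ-injective
            (+-cancelˡ-≡ lo _ _ (pos-≡ (lo + toℕ j) (m≤m+n lo (toℕ j)) (s≤s i≤hi)))))))
          where
          i≤hi : lo + toℕ j ≤ hi
          i≤hi = +-monoʳ-≤ lo (≤-pred (toℕ<n j))
        above : ∀ i → i < 2 + n → hi < i → fc a i ≡ fc a₀ i
        above i p q = trans (fc-mk E p) (trans (cat-≥ (<⇒≤ (<-trans lo<hi q))) (cat-≥ q))
        outside : ∀ i → Outside lo hi i → fc a i ≡ fc a₀ i
        outside i (inj₁ p) with m≤n⇒m<n∨m≡n p
        ... | inj₁ l = trans (fc-mk E (<-trans l (<-trans lo<hi (s≤s hi≤)))) (cat-< l)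
        ... | inj₂ refl = trans (lifts-x Φ lifts) (sym a₀-x)
        outside i (inj₂ p) with m≤n⇒m<n∨m≡n p
        ... | inj₂ refl = trans (lifts-y Φ lifts) (sym a₀-y)
        ... | inj₁ l with i <? 2 + n
        ...   | yes q = above i q l
        ...   | no ¬q with m≤n⇒m<n∨m≡n hi≤
        ...     | inj₁ h = trans (fc-over a (≮⇒≥ ¬q)) (trans (above (suc n) ≤-refl h) (sym (fc-over a₀ (≮⇒≥ ¬q))))
        ...     | inj₂ h = trans (fc-over a (≮⇒≥ ¬q)) (trans (cong (fc a) (sym h))
                    (trans (lifts-y Φ lifts) (trans (sym a₀-y) (trans (cong (fc a₀) h) (sym (fc-over a₀ (≮⇒≥ ¬q)))))))

    restrict : ∀ a → fc a lo ≡ x → fc a hi ≡ y → ∃[ Φ ] Lifts a Φ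
    restrict a ax ay = record
      { face = λ i → fc a (lo + toℕ i) ,
          subst (_⊑ fc a (lo + toℕ i)) ax (fc-mono a (m≤m+n lo (toℕ i))) ,
          subst (fc a (lo + toℕ i) ⊑_) ay (fc-mono a (i≤hi i))
      ; rank-ok = λ i → trans (cong₂ _∸_ (fc-rank a (≤-<-trans (i≤hi i) (s≤s hi≤))) rx) (m+n∸m≡n lo (toℕ i))
      ; chain = λ i j p → fc-mono a (+-monoʳ-≤ lo p) } , λ _ → refl
      where
      i≤hi : (i : Fin (2 + k)) → lo + toℕ i ≤ hi
      i≤hi i = +-monoʳ-≤ lo (≤-pred (toℕ<n i))

    -- Both lifted flags contain x and y, so the automorphism fixes these faces and preserves the
    -- section.
    restrict-orbit : ∀ {a b} Φ Ψ → Lifts a Φ → Lifts b Ψ → a ~ b → SameOrbit S Φ Ψ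
    restrict-orbit {a} {b} Φ Ψ la lb s@(φ , _) = record
      { fun = λ { (H , p , q) → fun H , subst (_⊑ fun H) fx (fun-mono p) , subst (fun H ⊑_) fy (fun-mono q) }
      ; inv = λ { (H , p , q) → inv H , fun-refl (subst₂ _⊑_ (sym fx) (sym (fun-inv H)) p) ,
                                        fun-refl (subst₂ _⊑_ (sym (fun-inv H)) (sym fy) q) }
      ; inv-fun = λ { (H , _) → S-≡ (inv-fun H) }
      ; fun-inv = λ { (H , _) → S-≡ (fun-inv H) }
      ; fun-mono = fun-mono
      ; fun-refl = fun-refl } ,
      λ i → S-≡ (trans (cong fun (sym (la i)))
        (trans (orbit-fc {a} {b} s (≤-<-trans (+-monoʳ-≤ lo (≤-pred (toℕ<n i))) (s≤s hi≤))) (lb i)))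
      where
      open Automorphism φ
      fx : fun x ≡ x
      fx = trans (cong fun (sym (lifts-x Φ la))) (trans (orbit-fc {a} {b} s (<-trans lo<hi (s≤s hi≤))) (lifts-x Ψ lb))
      fy : fun y ≡ y
      fy = trans (cong fun (sym (lifts-y Φ la))) (trans (orbit-fc {a} {b} s (s≤s hi≤)) (lifts-y Ψ lb))

    -- By `rel-closed`, the automorphism of the section makes every word closing at a close at
    -- `r t a` too, which is the comparison that `reg-from` asks for.
    reg-orbit : ∀ {a t} Φ Ψ → Inside lo hi t → Lifts a Φ → Lifts (r t a) Ψ → SameOrbit S Φ Ψ → Reg lo hi
    reg-orbit {a} {t} Φ Ψ inside la lb (α , h) = reg-from hi≤ inside a λ w W → rel-closed w W rel
      where
      open Automorphism α
      R : Face → Face → Set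
      R u u′ = Σ (x ⊑ u × u ⊑ y) λ p → proj₁ (fun (u , p)) ≡ u′
      mono : ∀ {u u′ v v′} → R u u′ → R v v′ → u ⊑ v → u′ ⊑ v′
      mono (_ , refl) (_ , refl) p = fun-mono p
      inj : ∀ {u u′ v v′} → R u u′ → R v v′ → u′ ≡ v′ → u ≡ v
      inj (p , refl) (q , refl) e = cong proj₁ (trans (sym (inv-fun (_ , p))) (trans (cong inv (S-≡ e)) (inv-fun (_ , q))))
      functional : ∀ {u u′ u″} → R u u′ → R u u″ → u′ ≡ u″
      functional (p , refl) (q , refl) = cong (proj₁ ∘ fun) (S-≡ refl)
      total : ∀ {v v′ w w′ u} → R v v′ → R w w′ → v ⊑ u → u ⊑ w → ∃[ u′ ] R u u′
      total ((x⊑v , _) , _) ((_ , w⊑y) , _) p q = _ , (⊑-trans x⊑v p , ⊑-trans q w⊑y) , refl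
      open Transport R mono inj functional total {lo} {hi} hi≤
      rel : Rel a (r t a)
      rel i p q with position i p q
      ... | j , refl = subst₂ R (sym (la j)) (sym (lb j)) (proj₂ (face Φ j) , cong proj₁ (h j))

    reg-adjacent : ∀ Φ Ψ → Adjacent S Φ Ψ → SameOrbit S Φ Ψ → Reg lo hi
    reg-adjacent Φ Ψ (i , Φ≢Ψ , rest) s with lift Φ | lift Ψ
    ... | a , la , oa | b , lb , ob = reg-orbit {t = t} Φ Ψ inside la (subst (λ c → Lifts c Ψ) b≡ lb) s
      where
      t : ℕ
      t = lo + toℕ i
      i≢0 : toℕ i ≢ 0
      i≢0 e = Φ≢Ψ (S-≡ (trans (S-first Φ i e) (sym (S-first Ψ i e))))
      i≢1+k : toℕ i ≢ suc k
      i≢1+k e = Φ≢Ψ (S-≡ (trans (S-last Φ i e) (sym (S-last Ψ i e))))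
      inside : Inside lo hi t
      inside = m<m+n lo (n≢0⇒n>0 i≢0) , +-monoʳ-< lo (≤∧≢⇒< (≤-pred (toℕ<n i)) i≢1+k)
      agree : ∀ j → j ≢ t → fc b j ≡ fc a j
      agree j j≢t with j ≤? lo | hi ≤? j
      ... | yes p | _ = trans (ob j (inj₁ p)) (sym (oa j (inj₁ p)))
      ... | no _ | yes q = trans (ob j (inj₂ q)) (sym (oa j (inj₂ q)))
      ... | no p | no q with position j (<⇒≤ (≰⇒> p)) (<⇒≤ (≰⇒> q))
      ...   | m , refl = trans (lb m) (trans (cong proj₁ (sym (rest m λ e → j≢t (cong (λ z → lo + toℕ z) e)))) (sym (la m)))
      b≡ : b ≡ r t a
      b≡ = r-uniq′ (≤-<-trans z≤n (proj₁ inside) , <-≤-trans (proj₂ inside) hi≤) b agree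
        λ e → Φ≢Ψ (S-≡ (trans (sym (la i)) (trans (sym e) (lb i))))

    inside : Inside lo hi (suc lo)
    inside = n<1+n lo , subst (_≤ hi) (trans (+-suc lo 1) (cong suc (+-comm lo 1))) (+-monoʳ-≤ lo (s≤s 0<k))

    -- A flag and its neighbour across rank `suc lo` represent the orbits: automorphisms of `P`
    -- restricted to the section reach every flag from one of them, and an automorphism joining
    -- adjacent flags would give `Reg`.
    section-chiral : ¬ Reg lo hi → Chiral S
    section-chiral ¬reg with restrict a₀ a₀-x a₀-y | restrict (r (suc lo) a₀)
        (trans (r-same a₀ (<⇒≢ (n<1+n lo))) a₀-x)
        (trans (r-same a₀ (≢-sym (<⇒≢ (proj₂ inside)))) a₀-y)
    ... | Φ₀ , l₀ | Φ₁ , l₁ = (Φ₀ , Φ₁ , (λ s → ¬reg (reg-orbit Φ₀ Φ₁ inside l₀ l₁ s)) , cover) ,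
          λ Φ Ψ adj s → ¬reg (reg-adjacent Φ Ψ adj s)
      where
      cover : ∀ Ψ → SameOrbit S Φ₀ Ψ ⊎ SameOrbit S Φ₁ Ψ
      cover Ψ with lift Ψ
      ... | b , lb , _ with dichotomy {suc lo} (z<s , <-≤-trans (proj₂ inside) hi≤) a₀ b
      ...   | inj₁ s = inj₁ (restrict-orbit Φ₀ Ψ l₀ lb s)
      ...   | inj₂ s = inj₂ (restrict-orbit Φ₁ Ψ l₁ lb s)

-- Powers of words and cyclic arithmetic.

infixl 8 _^^_

_^^_ : List ℕ → ℕ → List ℕ
w ^^ zero  = []
w ^^ suc k = w ++ w ^^ k

^^-all : ∀ {Q : ℕ → Set} {w} → All Q w → ∀ k → All Q (w ^^ k)
^^-all W zero = []
^^-all W (suc k) = ++⁺ W (^^-all W k)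

^^-+ : ∀ w k l → w ^^ (k + l) ≡ w ^^ k ++ w ^^ l
^^-+ w zero l = refl
^^-+ w (suc k) l = trans (cong (w ++_) (^^-+ w k l)) (sym (++-assoc w (w ^^ k) (w ^^ l)))

cyc : ∀ {p} → Fin p → Fin p
cyc {suc p} e = fromℕ< (m%n<n (suc (toℕ e)) (suc p))

cycs : ∀ {p} → ℕ → Fin p → Fin p
cycs zero e = e
cycs (suc k) e = cycs k (cyc e)

cycs-cyc : ∀ {p} k (e : Fin p) → cycs k (cyc e) ≡ cyc (cycs k e)
cycs-cyc zero e = refl
cycs-cyc (suc k) e = cycs-cyc k (cyc e)

toℕ-cycs : ∀ {p} k (e : Fin (suc p)) → toℕ (cycs k e) ≡ (toℕ e + k) % suc p
toℕ-cycs {p} zero e = sym (trans (cong (_% suc p) (+-identityʳ (toℕ e))) (m<n⇒m%n≡m (toℕ<n e)))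
toℕ-cycs {p} (suc k) e = begin
  toℕ (cycs k (cyc e))                     ≡⟨ toℕ-cycs k (cyc e) ⟩
  (toℕ (cyc e) + k) % q                    ≡⟨ cong (λ m → (m + k) % q) (toℕ-fromℕ< (m%n<n (suc (toℕ e)) q)) ⟩
  (suc (toℕ e) % q + k) % q                ≡⟨ %-distribˡ-+ (suc (toℕ e) % q) k q ⟩
  (suc (toℕ e) % q % q + k % q) % q        ≡⟨ cong (λ m → (m + k % q) % q) (m%n%n≡m%n (suc (toℕ e)) q) ⟩
  (suc (toℕ e) % q + k % q) % q            ≡⟨ %-distribˡ-+ (suc (toℕ e)) k q ⟨
  (suc (toℕ e) + k) % q                    ≡⟨ cong (_% q) (sym (+-suc (toℕ e) k)) ⟩
  (toℕ e + suc k) % q                      ∎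
  where
  open ≡-Reasoning
  q = suc p

cycs-period : ∀ {p} (e : Fin p) → cycs p e ≡ e
cycs-period {suc p} e = toℕ-injective (trans (toℕ-cycs (suc p) e)
  (trans ([m+n]%n≡m%n (toℕ e) (suc p)) (m<n⇒m%n≡m (toℕ<n e))))

cyc-injective : ∀ {p} {d e : Fin p} → cyc d ≡ cyc e → d ≡ e
cyc-injective {suc p} {d} {e} eq = trans (sym (cycs-period d)) (trans (cong (cycs p) eq) (cycs-period e))

-- If the sum of `toℕ e` and k stays below the modulus, it is its own residue; after a wrap one
-- subtraction of the modulus suffices, and a return would force k to equal the modulus.
cycs-return : ∀ {p} k (e : Fin p) → k < p → cycs k e ≡ e → k ≡ 0
cycs-return {suc p} k e k<q eq with toℕ e + k <? suc p
... | yes l = m+n≡m⇒n≡0 (trans (sym (m<n⇒m%n≡m l)) e+k)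
  where
  m+n≡m⇒n≡0 : toℕ e + k ≡ toℕ e → k ≡ 0
  m+n≡m⇒n≡0 h = +-cancelˡ-≡ (toℕ e) k 0 (trans h (sym (+-identityʳ (toℕ e))))
  e+k : (toℕ e + k) % suc p ≡ toℕ e
  e+k = trans (sym (toℕ-cycs k e)) (cong toℕ eq)
... | no ¬l = contradiction k<q (≤⇒≯ (≤-reflexive q≡k))
  where
  q = suc p
  d : ℕ
  d = toℕ e + k ∸ q
  d+q : d + q ≡ toℕ e + k
  d+q = m∸n+n≡m (≮⇒≥ ¬l)
  d<q : d < q
  d<q = +-cancelʳ-< q d q (subst (_< q + q) (sym d+q) (+-mono-< (toℕ<n e) k<q))
  d≡e : d ≡ toℕ e
  d≡e = begin
    d                     ≡⟨ m<n⇒m%n≡m d<q ⟨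
    d % q                 ≡⟨ [m+n]%n≡m%n d q ⟨
    (d + q) % q           ≡⟨ cong (_% q) d+q ⟩
    (toℕ e + k) % q       ≡⟨ toℕ-cycs k e ⟨
    toℕ (cycs k e)        ≡⟨ cong toℕ eq ⟩
    toℕ e                 ∎
    where open ≡-Reasoning
  q≡k : q ≡ k
  q≡k = +-cancelˡ-≡ (toℕ e) q k (trans (cong (_+ q) (sym d≡e)) d+q)

incident-cyc : ∀ {p} {j e : Fin p} → Incident j e → j ≡ e ⊎ j ≡ cyc e
incident-cyc (inj₁ eq) = inj₁ (toℕ-injective eq)
incident-cyc {suc p} {j} {e} (inj₂ (inj₁ eq)) = inj₂ (toℕ-injective (trans eq (sym
  (trans (toℕ-fromℕ< (m%n<n (suc (toℕ e)) (suc p))) (m<n⇒m%n≡m (subst (_< suc p) eq (toℕ<n j)))))))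
incident-cyc {suc p} {j} {e} (inj₂ (inj₂ (j≡0 , eq))) = inj₂ (toℕ-injective (trans j≡0 (sym
  (trans (toℕ-fromℕ< (m%n<n (suc (toℕ e)) (suc p))) (trans (cong (_% suc p) eq) (n%n≡0 (suc p)))))))

-- Rotations of polygonal sections.

module Rotations {n : ℕ} (P : GradedPoset n) (isP : IsPolytope P) {N : ℕ} (count : HasFlagCount P N) where

  open Flags P isP count

  rot : ℕ → List ℕ
  rot j = suc j ∷ suc (suc j) ∷ []

  rot⁻ : ℕ → List ℕ
  rot⁻ j = suc (suc j) ∷ suc j ∷ []

  rot⁻-rot : ∀ j k a → act (rot j ^^ k) (act (rot⁻ j ^^ k) a) ≡ a
  rot⁻-rot j zero a = refl
  rot⁻-rot j (suc k) a = begin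
    act (rot j ^^ suc k) (act (rot⁻ j ^^ suc k) a)
      ≡⟨ cong (λ w → act w (act (rot⁻ j ^^ suc k) a)) (trans (cong (rot j ^^_) (+-comm 1 k)) (^^-+ (rot j) k 1)) ⟩
    act (rot j ^^ k ++ rot j) (act (rot⁻ j ^^ k) (act (rot⁻ j) a))
      ≡⟨ act-++ (rot j ^^ k) ⟩
    act (rot j) (act (rot j ^^ k) (act (rot⁻ j ^^ k) (act (rot⁻ j) a)))
      ≡⟨ cong (act (rot j)) (rot⁻-rot j k (act (rot⁻ j) a)) ⟩
    act (rot j) (act (rot⁻ j) a)
      ≡⟨ trans (cong (r (2 + j)) (r-invol (suc j) _)) (r-invol (2 + j) a) ⟩
    a ∎
    where open ≡-Reasoning

  module Gon {j p : ℕ} (j≤ : 2 + j ≤ n) {F G : Face} (gon : IsPGon (Section P F G 2) p) where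

    private
      to = proj₁ gon
      from = proj₁ (proj₂ gon)
      from-to = proj₁ (proj₂ (proj₂ gon))
      to-mono = proj₁ (proj₂ (proj₂ (proj₂ (proj₂ gon))))
      to-refl = proj₂ (proj₂ (proj₂ (proj₂ (proj₂ gon))))
      v₁ : Valid (1 + j)
      v₁ = z<s , s≤s (≤-trans (n≤1+n (suc j)) j≤)
      v₂ : Valid (2 + j)
      v₂ = z<s , s≤s j≤

    At : Face → PGonFace p → Set
    At H f = Σ (F ⊑ H × H ⊑ G) λ q → to (H , q) ≡ f

    at-functional : ∀ {H f g} → At H f → At H g → f ≡ g
    at-functional ((p , q) , refl) ((p′ , q′) , refl) =
      cong₂ (λ u v → to (_ , u , v)) (⊑-irrelevant p p′) (⊑-irrelevant q q′)

    at-injective : ∀ {H K f} → At H f → At K f → H ≡ K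
    at-injective (p , e) (q , e′) = cong proj₁ (trans (sym (from-to (_ , p))) (trans (cong from (trans e (sym e′))) (from-to (_ , q))))

    On : X → Set
    On a = fc a j ≡ F × fc a (3 + j) ≡ G

    -- An isomorphism with the p-gon is not assumed to respect ranks; incidence forces it to.
    classify : ∀ {H K} → _<_ₚ P F H → _<_ₚ P H K → _<_ₚ P K G →
               ∃[ v ] ∃[ e ] (At H (vert v) × At K (edge e) × Incident v e)
    classify {H} {K} (F⊑H , F≢H) (H⊑K , H≢K) (K⊑G , K≢G) = go (to h) (to k) refl refl (to-mono h k H⊑K)
      where
      h k least greatest : GradedPoset.Face (Section P F G 2)
      h = H , F⊑H , ⊑-trans H⊑K K⊑G
      k = K , ⊑-trans F⊑H H⊑K , K⊑G
      least = F , ⊑-refl F , ⊑-trans F⊑H (⊑-trans H⊑K K⊑G)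
      greatest = G , ⊑-trans F⊑H (⊑-trans H⊑K K⊑G) , ⊑-refl G
      H≢K′ : to h ≢ to k
      H≢K′ e = H≢K (cong proj₁ (trans (sym (from-to h)) (trans (cong from e) (from-to k))))
      go : ∀ f g → to h ≡ f → to k ≡ g → f ≤PG g → ∃[ v ] ∃[ e ] (At H (vert v) × At K (edge e) × Incident v e)
      go pbot g eh ek _ = ⊥-elim (F≢H (⊑-antisym F⊑H (to-refl h least (subst (_≤PG to least) (sym eh) _))))
      go (vert v) (vert w) eh ek refl = ⊥-elim (H≢K′ (trans eh (sym ek)))
      go (vert v) (edge e) eh ek i = v , e , (proj₂ h , eh) , (proj₂ k , ek) , i
      go (edge e) (edge f) eh ek refl = ⊥-elim (H≢K′ (trans eh (sym ek)))
      go ptop ptop eh ek _ = ⊥-elim (H≢K′ (trans eh (sym ek)))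
      go f ptop eh ek _ = ⊥-elim (K≢G (⊑-antisym K⊑G (to-refl greatest k (subst (to greatest ≤PG_) (sym ek) (≤ptop (to greatest))))))
        where
        ≤ptop : ∀ f → f ≤PG ptop
        ≤ptop pbot = _
        ≤ptop (vert _) = _
        ≤ptop (edge _) = _
        ≤ptop ptop = _

    -- The cases of `incident` are the two orientations of a flag: its vertex is the start or the
    -- end of its edge. The rotation shifts flags of the first kind forward and those of the second
    -- kind backward.
    record VE (a : X) (v e : Fin p) : Set where
      constructor ve
      field
        on : On a
        atV : At (fc a (1 + j)) (vert v)
        atE : At (fc a (2 + j)) (edge e)
        incident : v ≡ e ⊎ v ≡ cyc e

    describe : ∀ {a} → On a → ∃[ v ] ∃[ e ] VE a v e
    describe {a} on@(refl , refl) with classify (fc-< a (n<1+n j) (<-trans (proj₂ v₁) (n<1+n (suc n))))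
         (fc-< a (n<1+n (1 + j)) (<-trans (proj₂ v₂) (n<1+n (suc n)))) (fc-< a (n<1+n (2 + j)) (s≤s (s≤s j≤)))
    ... | v , e , V , E , i = v , e , ve on V E (incident-cyc i)

    on-r : ∀ {a t} → Inside j (3 + j) t → On a → On (r t a)
    on-r {a} inside (p , q) = trans (r-same a (out≢in (inj₁ ≤-refl) inside)) p ,
                              trans (r-same a (out≢in (inj₂ ≤-refl) inside)) q

    in₁ : Inside j (3 + j) (1 + j)
    in₁ = n<1+n j , <-trans (n<1+n (1 + j)) (n<1+n (2 + j))

    in₂ : Inside j (3 + j) (2 + j)
    in₂ = <-trans (n<1+n j) (n<1+n (1 + j)) , n<1+n (2 + j)

    flipV : ∀ {a v e} → VE a v e → ∃[ v′ ] (v′ ≢ v × VE (r (1 + j) a) v′ e)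
    flipV {a} {v} {e} (ve on V E i) with describe (on-r in₁ on)
    ... | v′ , e′ , w@(ve _ V′ E′ _) = v′ , (λ { refl → r-diff a v₁ (at-injective V′ V) }) ,
          subst (VE _ v′) (edge-injective (at-functional E′ (subst (λ H → At H (edge e)) (sym (r-same a (≢-sym (<⇒≢ (n<1+n (1 + j)))))) E))) w
      where
      edge-injective : ∀ {e e′ : Fin p} → edge e ≡ edge e′ → e ≡ e′
      edge-injective refl = refl

    flipE : ∀ {a v e} → VE a v e → ∃[ e′ ] (e′ ≢ e × VE (r (2 + j) a) v e′)
    flipE {a} {v} {e} (ve on V E i) with describe (on-r in₂ on)
    ... | v′ , e′ , w@(ve _ V′ E′ _) = e′ , (λ { refl → r-diff a v₂ (at-injective E′ E) }) ,
          subst (λ z → VE _ z e′) (vert-injective (at-functional V′ (subst (λ H → At H (vert v)) (sym (r-same a (<⇒≢ (n<1+n (1 + j))))) V))) w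
      where
      vert-injective : ∀ {v v′ : Fin p} → vert v ≡ vert v′ → v ≡ v′
      vert-injective refl = refl

    forward : ∀ {a e} → VE a e e → VE (act (rot j) a) (cyc e) (cyc e)
    forward s with flipV s
    ... | v , v≢e , ve _ _ _ (inj₁ v≡e) = contradiction v≡e v≢e
    ... | v , v≢e , s′@(ve _ _ _ (inj₂ refl)) with flipE s′
    ...   | e , e≢ , s″@(ve _ _ _ (inj₁ refl)) = s″
    ...   | e , e≢ , ve _ _ _ (inj₂ q) = contradiction (sym (cyc-injective q)) e≢

    -- The step back is expressed through a preimage under `cyc`, which avoids a predecessor modulo
    -- p.
    backward : ∀ {a e} → VE a (cyc e) e → ∃[ e′ ] (cyc e′ ≡ e × VE (act (rot j) a) (cyc e′) e′)
    backward s with flipV s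
    ... | v , v≢ , ve _ _ _ (inj₂ q) = contradiction q v≢
    ... | v , v≢ , s′@(ve _ _ _ (inj₁ refl)) with flipE s′
    ...   | e′ , e′≢ , ve _ _ _ (inj₁ q) = contradiction (sym q) e′≢
    ...   | e′ , e′≢ , s″@(ve _ _ _ (inj₂ q)) = e′ , sym q , subst (λ z → VE _ z e′) q s″

    forward^ : ∀ k {a e} → VE a e e → VE (act (rot j ^^ k) a) (cycs k e) (cycs k e)
    forward^ zero s = s
    forward^ (suc k) s = forward^ k (forward s)

    backward^ : ∀ k {a e} → VE a (cyc e) e → ∃[ e′ ] (cycs k e′ ≡ e × VE (act (rot j ^^ k) a) (cyc e′) e′)
    backward^ zero s = _ , refl , s
    backward^ (suc k) s with backward s
    ... | e₁ , q , s₁ with backward^ k s₁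
    ...   | e₂ , q′ , s₂ = e₂ , trans (cycs-cyc k e₂) (trans (cong cyc q′) q) , s₂

    VE-edge : ∀ {a b v w d e} → VE a v d → VE b w e → fc a (2 + j) ≡ fc b (2 + j) → d ≡ e
    VE-edge (ve _ _ E _) (ve _ _ E′ _) q with at-functional E (subst (λ H → At H _) (sym q) E′)
    ... | refl = refl

    VE-vert : ∀ {a b v w d e} → VE a v d → VE b w e → fc a (1 + j) ≡ fc b (1 + j) → v ≡ w
    VE-vert (ve _ V _ _) (ve _ V′ _ _) q with at-functional V (subst (λ H → At H _) (sym q) V′)
    ... | refl = refl

    return : ∀ {a} → On a → ∀ k → k < p →
             fc (act (rot j ^^ k) a) (1 + j) ≡ fc a (1 + j) ⊎ fc (act (rot j ^^ k) a) (2 + j) ≡ fc a (2 + j) → k ≡ 0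
    return on k k<p h with describe on
    ... | v , e , s@(ve _ _ _ (inj₁ refl)) = cycs-return k e k<p
          ([ VE-vert (forward^ k s) s , VE-edge (forward^ k s) s ]′ h)
    ... | v , e , s@(ve _ _ _ (inj₂ refl)) with backward^ k s
    ...   | e′ , q , s′ = cycs-return k e′ k<p (trans q (sym ([ cyc-injective ∘ VE-vert s′ s , VE-edge s′ s ]′ h)))

  -- The two return conditions are dual. Extending a range of ranks upward watches the face of rank
  -- `2 + j`, which words in the smaller range leave fixed; extending it downward watches rank
  -- `1 + j`.
  record Rotation (j p : ℕ) : Set where
    field
      valid : 2 + j ≤ n
      return-upper : ∀ a k → k < p → fc (act (rot j ^^ k) a) (2 + j) ≡ fc a (2 + j) → k ≡ 0
      return-lower : ∀ a k → k < p → fc (act (rot⁻ j ^^ k) a) (1 + j) ≡ fc a (1 + j) → k ≡ 0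

  rotation : ∀ {p} → Equivelar P p → ∀ i → 2 + toℕ i ≤ n → Rotation (toℕ i) (p i)
  rotation {p} eqv i v = record
    { valid = v
    ; return-upper = λ a k k<p e → G.return a (refl , refl) k k<p (inj₂ e)
    -- Read backwards: k rotations lead from b to a, so `return` is applied at b.
    ; return-lower = λ a k k<p e → let b = act (rot⁻ j ^^ k) a in
        G.return b (refl , refl) k k<p (inj₁ (trans (cong (λ c → fc c (1 + j)) (rot⁻-rot j k a)) (sym e))) }
    where
    j = toℕ i
    module G a = Gon v (eqv i (fc a j) (fc a (3 + j))
      (fc-rank a (≤-trans (n≤1+n (suc j)) (≤-trans v (≤-trans (n≤1+n n) (n≤1+n (suc n)))))) (fc-rank a (s≤s (s≤s v))) (fc-mono a (m≤n+m j 3)))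

-- Finite sets.

injective⇒surjective : ∀ {M N} → M ≡ N → (f : Fin M → Fin N) → (∀ {x y} → f x ≡ f y → x ≡ y) → ∀ y → ∃[ x ] f x ≡ y
injective⇒surjective {suc M} refl f inj y with any? (λ x → f x Finₚ.≟ y)
... | yes s = s
... | no ¬s = contradiction (injective⇒≤ {f = λ x → punchOut (avoids x)} λ {x} {x′} e → inj (punchOut-injective (avoids x) (avoids x′) e)) 1+n≰n
  where
  avoids : ∀ x → y ≢ f x
  avoids x e = ¬s (x , sym e)

¬¬-all : ∀ {m} {Q : Fin m → Set} → (∀ i → ¬ ¬ Q i) → ¬ ¬ (∀ i → Q i)
¬¬-all {zero} h k = k λ ()
¬¬-all {suc m} h k = h Fin.zero λ q₀ → ¬¬-all (h ∘ Fin.suc) λ qs → k λ { Fin.zero → q₀ ; (Fin.suc i) → qs i }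

anyVec? : ∀ {N m} {Q : Vec (Fin N) m → Set} → (∀ v → Dec (Q v)) → Dec (∃ Q)
anyVec? {m = zero} Q? with Q? Vec.[]
... | yes q = yes (Vec.[] , q)
... | no ¬q = no λ { (Vec.[] , q) → ¬q q }
anyVec? {m = suc m} Q? with any? (λ x → anyVec? (λ v → Q? (x Vec.∷ v)))
... | yes (x , v , q) = yes (x Vec.∷ v , q)
... | no ¬q = no λ { (x Vec.∷ v , q) → ¬q (x , v , q) }

-- Counting flags.

module Covers {n : ℕ} (P : GradedPoset n) (isP : IsPolytope P) {N : ℕ} (count : HasFlagCount P N) where

  open Flags P isP count
  open Orbits P isP count
  open Rotations P isP count

  act-injective : ∀ w {a b} → act w a ≡ act w b → a ≡ b
  act-injective w {a} {b} e = trans (sym (act-reverse w a)) (trans (cong (act (reverse w)) e) (act-reverse w b))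

  record Cover (a₀ : X) (lo hi M : ℕ) : Set where
    field
      at : Fin M → X
      injective : ∀ {x y} → at x ≡ at y → x ≡ y
      joined : ∀ x → Joined lo hi a₀ (at x)

    outside : ∀ x i → Outside lo hi i → fc (at x) i ≡ fc a₀ i
    outside x i o with joined x
    ... | w , W , e = trans (cong (λ a → fc a i) (sym e)) (act-outside w W o)

    Full : Set
    Full = ∀ a → Agree lo hi a₀ a → ∃[ x ] at x ≡ a

  open Cover

  -- The powers of w below p move a face t which C leaves fixed, so they multiply the number of
  -- flags covered; starting from 2 this yields the lower bound 2p₁⋯pₙ₋₁, attained in the tight case.
  module _ {a₀ lo hi M} (C : Cover a₀ lo hi M) {lo′ hi′ p t : ℕ} (w : List ℕ)
           (lo′≤ : lo′ ≤ lo) (hi≤ : hi ≤ hi′) (W : Within lo′ hi′ w) (fixed : Outside lo hi t)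
           (returns : ∀ a k → k < p → fc (act (w ^^ k) a) t ≡ fc a t → k ≡ 0) where

    private
      same-t : ∀ x y → fc (at C x) t ≡ fc (at C y) t
      same-t x y = trans (outside C x t fixed) (sym (outside C y t fixed))

      no-wrap : ∀ x y k m → k + m < p → act (w ^^ k) (at C x) ≡ act (w ^^ (k + m)) (at C y) → m ≡ 0 × x ≡ y
      no-wrap x y k m lt e = m≡0 , injective C (trans e′ (cong (λ z → act (w ^^ z) (at C y)) m≡0))
        where
        split : act (w ^^ (k + m)) (at C y) ≡ act (w ^^ k) (act (w ^^ m) (at C y))
        split = trans (cong (λ v → act v (at C y)) (trans (cong (w ^^_) (+-comm k m)) (^^-+ w m k))) (act-++ (w ^^ m))
        e′ : at C x ≡ act (w ^^ m) (at C y)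
        e′ = act-injective (w ^^ k) (trans e split)
        m≡0 : m ≡ 0
        m≡0 = returns (at C y) m (≤-<-trans (m≤n+m m k) lt)
          (trans (cong (λ a → fc a t) (sym e′)) (same-t x y))

      unique : ∀ x y k l → k < p → l < p → act (w ^^ k) (at C x) ≡ act (w ^^ l) (at C y) → x ≡ y × k ≡ l
      unique x y k l k<p l<p e with ≤-total k l
      ... | inj₁ k≤l with m+[n∸m]≡n k≤l
      ...   | q with no-wrap x y k (l ∸ k) (subst (_< p) (sym q) l<p) (trans e (cong (λ z → act (w ^^ z) (at C y)) (sym q)))
      ...     | m≡0 , x≡y = x≡y , trans (sym (trans (cong (k +_) m≡0) (+-identityʳ k))) q
      unique x y k l k<p l<p e | inj₂ l≤k with m+[n∸m]≡n l≤k
      ...   | q with no-wrap y x l (k ∸ l) (subst (_< p) (sym q) k<p) (trans (sym e) (cong (λ z → act (w ^^ z) (at C x)) (sym q)))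
      ...     | m≡0 , y≡x = sym y≡x , sym (trans (sym (trans (cong (l +_) m≡0) (+-identityʳ l))) q)

      image : Fin M × Fin p → X
      image (x , k) = act (w ^^ toℕ k) (at C x)

    extend : Cover a₀ lo′ hi′ (M * p)
    extend = record
      { at = λ z → image (remQuot p z)
      ; injective = λ {z} {z′} e → inj z z′ (unique _ _ _ _ (toℕ<n (proj₂ (remQuot {M} p z))) (toℕ<n (proj₂ (remQuot {M} p z′))) e)
      ; joined = λ z → joined-trans (joined-mono lo′≤ hi≤ (joined C (proj₁ (remQuot {M} p z))))
                         (w ^^ toℕ (proj₂ (remQuot {M} p z)) , ^^-all W (toℕ (proj₂ (remQuot {M} p z))) , refl) }
      where
      inj : ∀ z z′ → proj₁ (remQuot {M} p z) ≡ proj₁ (remQuot {M} p z′) ×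
            toℕ (proj₂ (remQuot {M} p z)) ≡ toℕ (proj₂ (remQuot {M} p z′)) → z ≡ z′
      inj z z′ (e , e′) = trans (sym (combine-remQuot {M} p z))
        (trans (cong₂ combine e (toℕ-injective e′)) (combine-remQuot {M} p z′))

    factor : Full extend → ∀ a → Agree lo′ hi′ a₀ a → ∃[ x ] ∃[ k ] (k < p × act (w ^^ k) (at C x) ≡ a)
    factor full a ag with full a ag
    ... | z , e = proj₁ (remQuot {M} p z) , toℕ (proj₂ (remQuot {M} p z)) , toℕ<n _ , e

    -- A flag agreeing with `a₀` outside the smaller range has the same face t, so the power of `w`
    -- used to reach it returns that face and is trivial. Thus exhaustion of the flags of `P` passes
    -- down to sections.
    full-base : Full extend → Full C
    full-base full a ag with factor full a (λ i o → ag i (outside-mono lo′≤ hi≤ o))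
    ... | x , k , k<p , e with returns (at C x) k k<p
          (trans (cong (λ b → fc b t) e) (trans (sym (ag t fixed)) (sym (outside C x t fixed))))
    ...   | refl = x , e

  trivial : ∀ a₀ l → Cover a₀ l (suc l) 1
  trivial a₀ l = record { at = const a₀ ; injective = λ { {Fin.zero} {Fin.zero} _ → refl } ; joined = λ _ → [] , [] , refl }

  -- The leading 2 of the flag count: a single involution acts as a rotation of order two moving the
  -- face of rank `suc l`.
  edges : ∀ a₀ l → l < n → Cover a₀ l (2 + l) 2
  edges a₀ l l<n = extend (trivial a₀ l) {t = suc l} [ suc l ] ≤-refl (n≤1+n _)
    ((n<1+n l , n<1+n (suc l)) ∷ []) (inj₂ ≤-refl) returns
    where
    returns : ∀ a k → k < 2 → fc (act ([ suc l ] ^^ k) a) (suc l) ≡ fc a (suc l) → k ≡ 0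
    returns a zero _ _ = refl
    returns a (suc zero) _ e = contradiction e (r-diff a (z<s , s≤s l<n))
    returns a (suc (suc k)) (s≤s (s≤s ())) _

  module Up {a₀ lo l M p} (C : Cover a₀ lo (2 + l) M) (lo≤ : lo ≤ l) (ρ : Rotation l p) where
    open Rotation ρ
    private
      W : Within lo (3 + l) (rot l)
      W = (s≤s lo≤ , ≤-trans (n≤1+n _) ≤-refl) ∷ (s≤s (≤-trans lo≤ (n≤1+n l)) , ≤-refl) ∷ []
    up : Cover a₀ lo (3 + l) (M * p)
    up = extend C (rot l) ≤-refl (n≤1+n _) W (inj₂ ≤-refl) return-upper
    up-full : Full up → Full C
    up-full = full-base C (rot l) ≤-refl (n≤1+n _) W (inj₂ ≤-refl) return-upper
    up-factor : Full up → ∀ a → Agree lo (3 + l) a₀ a → ∃[ x ] ∃[ k ] (k < p × act (rot l ^^ k) (at C x) ≡ a)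
    up-factor = factor C (rot l) ≤-refl (n≤1+n _) W (inj₂ ≤-refl) return-upper

  module Down {a₀ l hi M p} (C : Cover a₀ (suc l) hi M) (≤hi : 3 + l ≤ hi) (ρ : Rotation l p) where
    open Rotation ρ
    private
      W : Within l hi (rot⁻ l)
      W = (n≤1+n _ , ≤hi) ∷ (≤-refl , ≤-trans (n≤1+n _) ≤hi) ∷ []
    down : Cover a₀ l hi (M * p)
    down = extend C (rot⁻ l) (n≤1+n _) ≤-refl W (inj₁ ≤-refl) return-lower
    down-full : Full down → Full C
    down-full = full-base C (rot⁻ l) (n≤1+n _) ≤-refl W (inj₁ ≤-refl) return-lower

  full-top : ∀ {a₀ M} (C : Cover a₀ 0 (suc n) M) → M ≡ N → Full C
  full-top C e a _ = injective⇒surjective e (at C) (injective C) a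

  -- The flag b has the face of rank `3 + l` of `a₀` and the face of rank `1 + l` of a. So every
  -- vertex of such a section is incident with every facet of it, which is flatness in the usual
  -- sense.
  Flat : ℕ → ℕ → Set
  Flat l p = ∀ a₀ a → Agree l (4 + l) a₀ a →
             ∃[ b ] (Joined l (3 + l) a₀ b × ∃[ k ] (k < p × act (rot (suc l) ^^ k) b ≡ a))

  -- Modulo relations of the rank-three sections between l and 4 + l, every word takes the
  -- form u ρᵏ with u fixing the face 3 + l and ρ a rotation of order p about the face 1 + l.
  module Step {l p : ℕ} (ρ : Rotation (suc l) p) (flat : Flat l p)
              (reg-top : Reg l (4 + l)) (reg-low : Reg 0 (3 + l)) where
    open Rotation ρ

    w^ : ℕ → List ℕ
    w^ k = rot (suc l) ^^ k

    w^-within : ∀ k → Within (suc l) (4 + l) (w^ k)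
    w^-within = ^^-all ((≤-refl , n≤1+n _) ∷ (n≤1+n _ , ≤-refl) ∷ [])

    valid′ : ∀ {t} → Inside 0 (4 + l) t → Valid t
    valid′ (p , q) = p , <-≤-trans q (s≤s valid)

    commute : ∀ {t} → Inside 0 (4 + l) t → t ≤ l → ∀ w → Within (suc l) (4 + l) w → ∀ a → r t (act w a) ≡ act w (r t a)
    commute v t≤l [] [] a = refl
    commute {t} v t≤l (s ∷ w) ((p , q) ∷ ps) a = trans (commute v t≤l w ps (r s a))
      (cong (act w) (r-comm (valid′ v) (valid′ (≤-<-trans z≤n p , q)) (≤-<-trans (s≤s t≤l) p) a))

    -- The same u and k serve at every flag; this uniformity is what lets a closed word be moved
    -- from one flag to another.
    Normal : (X → X) → Set
    Normal f = ∃[ u ] ∃[ k ] (Within 0 (3 + l) u × k < p × (∀ a → f a ≡ act (w^ k) (act u a)))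

    normal-r : ∀ t {f} → Inside 0 (4 + l) t → X → Normal f → Normal (r t ∘ f)
    normal-r t {f} v a₀ (u , k , U , k<p , h) with t ≤? l
    ... | yes t≤l = u ++ [ t ] , k , ++⁺ U ((proj₁ v , ≤-trans (s≤s t≤l) (≤-trans (n≤1+n _) (n≤1+n _))) ∷ []) , k<p ,
          λ a → trans (cong (r t) (h a)) (trans (commute v t≤l (w^ k) (w^-within k) (act u a)) (cong (act (w^ k)) (sym (act-++ u))))
    -- `flat` rewrites the word only at `a₀`; all letters involved lie strictly between l and
    -- `4 + l`, so `reg-top` carries the identity to each `act u a`.
    ... | no t≰l with T ← ++⁺ (within-mono (n≤1+n l) ≤-refl (w^-within k)) ((≰⇒> t≰l , proj₂ v) ∷ [])
                 with flat a₀ (act (w^ k ++ [ t ]) a₀) (λ i o → sym (act-outside (w^ k ++ [ t ]) T o))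
    ...   | b , (u′ , U′ , e) , k′ , k′<p , e′ = u ++ u′ , k′ , ++⁺ U (within-mono z≤n ≤-refl U′) , k′<p ,
          λ a → trans (cong (r t) (h a)) (trans (sym (act-++ (w^ k)))
            (trans (reg-≡ reg-top (w^ k ++ [ t ]) (u′ ++ w^ k′) T T′ a₀ (act u a)
              (sym (trans (act-++ u′) (trans (cong (act (w^ k′)) e) e′))))
              (trans (act-++ u′) (cong (act (w^ k′)) (sym (act-++ u))))))
      where
      T′ : Within l (4 + l) (u′ ++ w^ k′)
      T′ = ++⁺ (within-mono ≤-refl (n≤1+n _) U′) (within-mono (n≤1+n l) ≤-refl (w^-within k′))

    normal : ∀ w {f} → Within 0 (4 + l) w → X → Normal f → Normal (act w ∘ f)
    normal [] [] a₀ N = N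
    normal (t ∷ w) (v ∷ vs) a₀ N = normal w vs a₀ (normal-r t v a₀ N)

    0<p : X → 0 < p
    0<p a₀ with flat a₀ a₀ (λ _ _ → refl)
    ... | _ , _ , _ , k<p , _ = ≤-<-trans z≤n k<p

    -- If w closes at a, the power of the rotation returns the face of rank `3 + l`, which u fixes;
    -- hence k is 0, and the remaining word u falls under `reg-low`.
    reg : Reg 0 (4 + l)
    reg w W a b e with normal w {id} W a ([] , 0 , [] , 0<p a , λ _ → refl)
    ... | u , k , U , k<p , h with return-upper (act u a) k k<p
          (trans (cong (λ c → fc c (3 + l)) (trans (sym (h a)) e)) (sym (act-outside u U (inj₂ ≤-refl))))
    ...   | refl = trans (h b) (reg-low u U a b (trans (sym (h a)) e))

  module Triple {l p q : ℕ} (ρ : Rotation l p) (σ : Rotation (suc l) q) (a₀ : X) where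
    private
      l<n : l < n
      l<n = ≤-trans (n≤1+n _) (Rotation.valid ρ)
      module A = Up (edges a₀ l l<n) ≤-refl ρ
      module B = Up A.up (n≤1+n l) σ

    triple : Cover a₀ l (4 + l) (2 * p * q)
    triple = B.up

    flat-at : Full triple → ∀ a → Agree l (4 + l) a₀ a →
              ∃[ b ] (Joined l (3 + l) a₀ b × ∃[ k ] (k < q × act (rot (suc l) ^^ k) b ≡ a))
    flat-at full a ag with B.up-factor full a ag
    ... | x , k , k<q , e = at A.up x , joined A.up x , k , k<q , e

-- Deciding regularity.

module Decide {n : ℕ} (P : GradedPoset n) (isP : IsPolytope P) {N : ℕ} (count : HasFlagCount P N) (ch : Chiral P) where

  open Flags P isP count
  open Orbits P isP count
  open Chirality P isP count ch

  Equivariant : ℕ → ℕ → X → X → Vec X N → Set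
  Equivariant lo hi a b f = lookup f a ≡ b ×
    (∀ {s} → s < hi → lo < s → ∀ c → lookup f (r s c) ≡ r s (lookup f c))

  equivariant? : ∀ lo hi a b f → Dec (Equivariant lo hi a b f)
  equivariant? lo hi a b f = (lookup f a Finₚ.≟ b) ×-dec
    allUpTo? (λ s → (lo <? s) →-dec all? (λ c → lookup f (r s c) Finₚ.≟ r s (lookup f c))) hi

  -- Reg lo hi amounts to the existence of a self-map of the finite set of flags which
  -- commutes with the generators strictly between lo and hi and moves a₀ to r t a₀.
  reg? : ∀ {lo hi t} → hi ≤ suc n → Inside lo hi t → X → Dec (Reg lo hi)
  reg? {lo} {hi} {t} hi≤ inside a₀ with anyVec? (equivariant? lo hi a₀ (r t a₀))
  ... | yes (f , base , equiv) = yes (reg-from hi≤ inside a₀ half)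
    where
    commutes : ∀ w → Within lo hi w → ∀ a → lookup f (act w a) ≡ act w (lookup f a)
    commutes [] [] a = refl
    commutes (s ∷ w) ((p , q) ∷ W) a = trans (commutes w W (r s a)) (cong (act w) (equiv q p a))
    half : ∀ w → Within lo hi w → act w a₀ ≡ a₀ → act w (r t a₀) ≡ r t a₀
    half w W e = trans (cong (act w) (sym base)) (trans (sym (commutes w W a₀)) (trans (cong (lookup f) e) base))
  -- Agreement with `a₀` compares faces, so it is decided only under a double negation; this is
  -- enough because the goal is a contradiction.
  ... | no none = no λ reg → ¬¬-all (λ a → ¬¬-excluded-middle {A = Agree lo hi a₀ a}) λ d → none (build reg d)
    where
    build : Reg lo hi → (∀ a → Dec (Agree lo hi a₀ a)) → ∃ (Equivariant lo hi a₀ (r t a₀))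
    build reg d = tabulate (λ a → g a (d a)) , trans (lookup∘tabulate _ a₀) (at-base (d a₀)) ,
      λ {s} q p a → trans (lookup∘tabulate _ (r s a)) (trans (step (p , q) a (d (r s a)) (d a)) (cong (r s) (sym (lookup∘tabulate _ a))))
      where
      g : ∀ a → Dec (Agree lo hi a₀ a) → X
      g a (yes ag) = act (proj₁ (connected lo hi hi≤ a₀ a ag)) (r t a₀)
      -- Flags outside the section stay in place; the generators preserve the set of these flags, so
      -- the map is still equivariant.
      g a (no _) = a
      at-base : ∀ da → g a₀ da ≡ r t a₀
      at-base (yes ag) with connected lo hi hi≤ a₀ a₀ ag
      ... | w , W , e = reg w W a₀ (r t a₀) e
      at-base (no ¬ag) = ⊥-elim (¬ag λ _ _ → refl)
      moved : ∀ {s} → Inside lo hi s → ∀ a → Agree lo hi a (r s a)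
      moved inside a i o = sym (r-same a (out≢in o inside))
      step : ∀ {s} → Inside lo hi s → ∀ a da′ da → g (r s a) da′ ≡ r s (g a da)
      step {s} in-s a (yes ag′) (yes ag) with connected lo hi hi≤ a₀ (r s a) ag′ | connected lo hi hi≤ a₀ a ag
      ... | v , V , e′ | w , W , e = trans (reg-≡ reg v (w ++ [ s ]) V (++⁺ W (in-s ∷ [])) a₀ (r t a₀)
            (trans e′ (sym (trans (act-++ w) (cong (r s) e))))) (act-++ w)
      step in-s a (no _) (no _) = refl
      step in-s a (yes ag′) (no ¬ag) = ⊥-elim (¬ag λ i o → trans (ag′ i o) (sym (moved in-s a i o)))
      step in-s a (no ¬ag′) (yes ag) = ⊥-elim (¬ag′ λ i o → trans (ag i o) (moved in-s a i o))

-- Tight chiral polytopes of ranks four and five.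

module Tight₄ (P : GradedPoset 4) (isP : IsPolytope P) (tight : Tight P) (ch : Chiral P) where

  private
    p : Fin 3 → ℕ
    p = proj₁ tight
    count : HasFlagCount P (2 * prodFin 3 p)
    count = proj₂ (proj₂ tight)

  open Flags P isP count public
  open Orbits P isP count public
  open Rotations P isP count
  open Covers P isP count
  open Chirality P isP count ch public
  open Decide P isP count ch public

  ρ₀ = rotation (proj₁ (proj₂ tight)) 0F (s≤s (s≤s z≤n))
  ρ₁ = rotation (proj₁ (proj₂ tight)) 1F (s≤s (s≤s (s≤s z≤n)))
  ρ₂ = rotation (proj₁ (proj₂ tight)) 2F (s≤s (s≤s (s≤s (s≤s z≤n))))

  -- Extending the triple downward by `ρ₀` reaches the total number of flags, so the triple already
  -- exhausts its section.
  flat : Flat 1 (p 2F)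
  flat a₀ = flat-at (down-full (full-top down size))
    where
    open Triple ρ₁ ρ₂ a₀
    open Down triple (s≤s (s≤s (s≤s z≤n))) ρ₀
    open +-*-Solver
    size : 2 * p 1F * p 2F * p 0F ≡ 2 * prodFin 3 p
    size = solve 3 (λ a b c → con 2 :* b :* c :* a := con 2 :* (a :* (b :* (c :* con 1)))) refl (p 0F) (p 1F) (p 2F)

  ¬regular : X → Reg 0 4 → ¬ Reg 1 5
  ¬regular a₀ facets figures = ¬Reg-all z<s a₀ (Step.reg ρ₂ flat figures facets)

module Tight₅ (P : GradedPoset 5) (isP : IsPolytope P) (tight : Tight P) (ch : Chiral P) where

  private
    p : Fin 4 → ℕ
    p = proj₁ tight
    count : HasFlagCount P (2 * prodFin 4 p)
    count = proj₂ (proj₂ tight)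

  open Flags P isP count public
  open Orbits P isP count public
  open Rotations P isP count
  open Covers P isP count
  open Chirality P isP count ch public

  ρ₀ = rotation (proj₁ (proj₂ tight)) 0F (s≤s (s≤s z≤n))
  ρ₁ = rotation (proj₁ (proj₂ tight)) 1F (s≤s (s≤s (s≤s z≤n)))
  ρ₂ = rotation (proj₁ (proj₂ tight)) 2F (s≤s (s≤s (s≤s (s≤s z≤n))))
  ρ₃ = rotation (proj₁ (proj₂ tight)) 3F (s≤s (s≤s (s≤s (s≤s (s≤s z≤n)))))

  -- A medial section must be extended at both ends before the flag count of `P` applies.
  flat₁ : Flat 1 (p 2F)
  flat₁ a₀ = flat-at (U.up-full (D.down-full (full-top D.down size)))
    where
    open Triple ρ₁ ρ₂ a₀
    module U = Up triple (s≤s z≤n) ρ₃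
    module D = Down U.up (s≤s (s≤s (s≤s z≤n))) ρ₀
    open +-*-Solver
    size : 2 * p 1F * p 2F * p 3F * p 0F ≡ 2 * prodFin 4 p
    size = solve 4 (λ a b c d → con 2 :* b :* c :* d :* a := con 2 :* (a :* (b :* (c :* (d :* con 1))))) refl (p 0F) (p 1F) (p 2F) (p 3F)

  flat₂ : Flat 2 (p 3F)
  flat₂ a₀ = flat-at (D₁.down-full (D₀.down-full (full-top D₀.down size)))
    where
    open Triple ρ₂ ρ₃ a₀
    module D₁ = Down triple (s≤s (s≤s (s≤s (s≤s z≤n)))) ρ₁
    module D₀ = Down D₁.down (s≤s (s≤s (s≤s z≤n))) ρ₀
    open +-*-Solver
    size : 2 * p 2F * p 3F * p 1F * p 0F ≡ 2 * prodFin 4 p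
    size = solve 4 (λ a b c d → con 2 :* c :* d :* b :* a := con 2 :* (a :* (b :* (c :* (d :* con 1))))) refl (p 0F) (p 1F) (p 2F) (p 3F)

  -- The inner `Step` yields `Reg 0 5`, the regular facets, which is the lower input of the outer
  -- one.
  ¬medial : X → ¬ Reg 1 5
  ¬medial a₀ medial = ¬Reg-all z<s a₀ (Step.reg ρ₃ flat₂ top₃ (Step.reg ρ₂ flat₁ medial bottom₃))
    where
    bottom₃ : Reg 0 4
    -- Words of a 3-face use shifted ranks at most 3, hence commute with the flip at the facet rank
    -- 5.
    bottom₃ = reg-commuting {t = 5} (m≤m+n 4 2) (z<s , n<1+n 5) λ s i → inj₁ (s≤s (proj₂ i))
    top₃ : Reg 2 6
    top₃ = reg-commuting {t = 1} ≤-refl (z<s , s≤s (s≤s z≤n)) λ s i → inj₂ (proj₁ i)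

theorem3p5 : ((P : GradedPoset 4) → IsPolytope P → Tight P → Chiral P →
    FacetsChiral P ⊎ VertexFiguresChiral P)
    × ((P : GradedPoset 5) → IsPolytope P → Tight P → Chiral P →
    FacetsChiral P × VertexFiguresChiral P × MedialSectionsChiral P)
theorem3p5 = rank₄ , rank₅
  where
  rank₄ : (P : GradedPoset 4) → IsPolytope P → Tight P → Chiral P → FacetsChiral P ⊎ VertexFiguresChiral P
  -- The disjunction needs a choice of side, while `¬regular` refutes only the two properties
  -- together.
  rank₄ P isP tight ch with reg? {0} {4} {1} (m≤m+n 4 1) (z<s , s≤s (s≤s z≤n)) base
    where
    open Tight₄ P isP tight ch
    base : X
    base = proj₁ (flagAt bottom)
  ... | no ¬reg = inj₁ λ B F rB rF B≤F → Sections.section-chiral B≤F rB rF z<s ¬reg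
    where open Tight₄ P isP tight ch
  ... | yes reg = inj₂ λ v T rv rT v≤T → Sections.section-chiral v≤T rv rT z<s (¬regular (proj₁ (flagAt v)) reg)
    where open Tight₄ P isP tight ch

  rank₅ : (P : GradedPoset 5) → IsPolytope P → Tight P → Chiral P →
          FacetsChiral P × VertexFiguresChiral P × MedialSectionsChiral P
  rank₅ P isP tight ch =
    -- Words of medial sections are among those of facets and of vertex-figures, so regularity of
    -- either would make medial sections regular; one refutation serves all three claims.
    (λ B F rB rF B≤F → Sections.section-chiral B≤F rB rF z<s (λ reg → ¬medial′ (reg-mono z≤n ≤-refl reg))) ,
    (λ v T rv rT v≤T → Sections.section-chiral v≤T rv rT z<s (λ reg → ¬medial′ (reg-mono ≤-refl (n≤1+n _) reg))) ,
    (λ v F rv rF v≤F → Sections.section-chiral v≤F rv rF z<s ¬medial′)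
    where
    open Tight₅ P isP tight ch
    ¬medial′ : ¬ Reg 1 5
    ¬medial′ = ¬medial (proj₁ (flagAt bottom))
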